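{- Let $d\ge 1$ and $m_1,\dots,m_d$ be positive integers, and let $M=[0,m_1]\times\cdots\times[0,m_d]\subset\mathbb{R}^d$. Then the minimum cardinality of a maximal system of brick islands in $M$ is \[ g_d(m_1,\dots,m_d)=\sum_{i=1}^d m_i-(d-1). \]
   Context: A brick of $M$ is a set $[a_1,b_1]\times\cdots\times[a_d,b_d]$ with $a_i,b_i\in\mathbb{Z}$ and $0\le a_i<b_i\le m_i$ for each $i$. A system of brick islands in $M$ is a set $H$ of bricks of $M$ such that for any $M_1,M_2\in H$, either $M_1\subseteq M_2$, $M_2\subseteq M_1$, or $M_1\cap M_2=\emptyset$. Let $I_M$ be the set of all systems of brick islands in $M$ and $Max(I_M)$ the set of its maximal elements with respect to inclusion (maximal systems). Define $g_d(m_1,\dots,m_d)=\min\{|H|: H\in Max(I_M)\}$. -}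

module Defs where

open import Data.Nat using (ℕ; _≤_; _<_; _+_; _∸_)
open import Data.Fin using (Fin)
open import Data.Vec using (Vec; lookup; sum)
open import Data.Product using (Σ; _×_; ∃)
open import Data.Sum using (_⊎_)
open import Data.List using (List; length)
open import Data.List.Relation.Unary.All using (All)
open import Data.List.Relation.Unary.Unique.Propositional using (Unique)
open import Data.List.Membership.Propositional using (_∈_)
open import Relation.Binary.PropositionalEquality using (_≡_)

-- A box [a_1,b_1] × ... × [a_d,b_d] with integer (natural) corners,
-- given by its vector of lower ends a and vector of upper ends b.
Box : ℕ → Set
Box d = Vec ℕ d × Vec ℕ d

lo : ∀ {d} → Box d → Vec ℕ d
lo (a Data.Product., _) = a

hi : ∀ {d} → Box d → Vec ℕ d
hi (_ Data.Product., b) = b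

IsBrick : ∀ {d} → Vec ℕ d → Box d → Set
IsBrick {d} m B = (i : Fin d) → (lookup (lo B) i < lookup (hi B) i) × (lookup (hi B) i ≤ lookup m i)

-- Set inclusion of (nondegenerate, closed) boxes, coordinatewise.
_⊆B_ : ∀ {d} → Box d → Box d → Set
_⊆B_ {d} B C = (i : Fin d) → (lookup (lo C) i ≤ lookup (lo B) i) × (lookup (hi B) i ≤ lookup (hi C) i)

-- Closed boxes are disjoint (as subsets of ℝ^d) iff in some coordinate
-- the closed intervals are disjoint.
DisjointB : ∀ {d} → Box d → Box d → Set
DisjointB {d} B C = ∃ λ (i : Fin d) → (lookup (hi B) i < lookup (lo C) i) ⊎ (lookup (hi C) i < lookup (lo B) i)

IsSystem : ∀ {d} → Vec ℕ d → List (Box d) → Set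
IsSystem m H = All (IsBrick m) H × Unique H
  × (∀ {B₁ B₂} → B₁ ∈ H → B₂ ∈ H → (B₁ ⊆B B₂) ⊎ (B₂ ⊆B B₁) ⊎ DisjointB B₁ B₂)

IsMaximalSystem : ∀ {d} → Vec ℕ d → List (Box d) → Set
IsMaximalSystem {d} m H = IsSystem m H
  × ((H' : List (Box d)) → IsSystem m H' → (∀ {B} → B ∈ H → B ∈ H') → ∀ {B} → B ∈ H' → B ∈ H)

IsMinMaxSystemSize : ∀ {d} → Vec ℕ d → ℕ → Set
IsMinMaxSystemSize {d} m n =
  (Σ (List (Box d)) λ H → IsMaximalSystem m H × length H ≡ n)
  × ((H : List (Box d)) → IsMaximalSystem m H → n ≤ length H)

{-# OPTIONS --safe #-}
-- Write w(B) = 1 + Σ (side length − 1) for a brick B.  A chain of bricks that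
-- loses one unit layer at a time is a maximal system with w(M) members.
--
-- For the lower bound, show by induction that at least w(B) members of a maximal
-- system lie in a member B.  This reduces to 1 + Σ w(C) ≥ w(B) over the maximal
-- proper members C ("children") of B; they are disjoint, and every brick in B
-- that contains or avoids each child is B itself or a child.  If some child
-- spans all axes but one, at most two children suffice.  Otherwise maximality
-- forces the children to cross every unit slab of B, and each edge of B to be
-- covered by the children touching it up to gaps of length at most 2.  Call an
-- axis deficient when the children's excess lengths along it sum to less than
-- that of B.  For two deficient axes, the children along the rim of a 2-face
-- in their directions number at least 2/3 of the two deficits.  Parallel
-- 2-faces in different positions then pay for three or more deficient axes, and
-- also for two if B has a third axis of length at least 2; if it has none, the
-- gaps have length at most 1 and a single rim suffices.
module Submission where

open import Defs
open import Data.Nat using (ℕ; zero; suc; pred; _+_; _*_; _∸_; _≤_; _<_; z≤n; s≤s; _≤?_; _<?_; >-nonZero)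
open import Data.Fin as Fin using (Fin; zero; suc)
open import Data.Vec as Vec using (Vec; []; _∷_; lookup; sum; tabulate)
open import Algebra.Properties.Semiring.Sum using ()
open import Data.Bool using (Bool; true; false; if_then_else_)
open import Data.Empty using (⊥)
open import Data.Fin.Properties as Finₚ using (any?; all?; ¬∀⟶∃¬)
open import Data.List as List using (List; []; _∷_; length; filter)
open import Data.List.Membership.Propositional using (_∈_; _∉_)
open import Data.List.Membership.Propositional.Properties using (∈-lookup; ∈-filter⁺; ∈-filter⁻)
import Data.List.Membership.DecPropositional as DecMembership
open import Data.List.Relation.Unary.All as All using (All; []; _∷_)
open import Data.List.Relation.Unary.All.Properties using (¬Any⇒All¬)
open import Data.List.Relation.Unary.AllPairs using ([]; _∷_)
open import Data.List.Relation.Unary.Any using (here; there; index)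
open import Data.List.Relation.Unary.Any.Properties using (lookup-index)
open import Data.List.Relation.Unary.Unique.Propositional using (Unique)
open import Data.List.Relation.Unary.Unique.Propositional.Properties using (filter⁺)
open import Data.Nat.Properties
open import Data.Nat.Solver using (module +-*-Solver)
open import Data.Product using (∃; _×_; _,_; proj₁; proj₂)
import Data.Product.Properties as Productₚ
open import Data.Sum using (_⊎_; inj₁; inj₂; [_,_]′; swap)
import Data.Vec.Properties as Vecₚ
open import Function using (_∘_)
open import Relation.Binary.PropositionalEquality
open import Relation.Nullary using (Dec; yes; no; does; ¬_; contradiction)
open import Relation.Nullary.Decidable using (_×-dec_; _⊎-dec_; _→-dec_; ¬?; dec-true; dec-false; decidable-stable)

open Algebra.Properties.Semiring.Sum +-*-semiring using (sum-cong-≗; ∑-distrib-+; ∑-comm; *-distribˡ-sum) renaming (sum to ∑)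
open +-*-Solver using (solve; _:=_; _:+_; _:*_; con)

-- Finite sums and counting

sum-mono : ∀ {n} {f g : Fin n → ℕ} → (∀ i → f i ≤ g i) → ∑ f ≤ ∑ g
sum-mono {zero}  f≤g = z≤n
sum-mono {suc n} f≤g = +-mono-≤ (f≤g zero) (sum-mono (f≤g ∘ suc))

sum-const : ∀ n a → ∑ {n} (λ _ → a) ≡ n * a
sum-const zero    a = refl
sum-const (suc n) a = cong (a +_) (sum-const n a)

term≤∑ : ∀ {n} (f : Fin n → ℕ) i → f i ≤ ∑ f
term≤∑ f zero    = m≤m+n _ _
term≤∑ f (suc i) = ≤-trans (term≤∑ (f ∘ suc) i) (m≤n+m _ _)

set : ∀ {d} {A : Set} → (Fin d → A) → Fin d → A → Fin d → A
set f i v j = if does (j Fin.≟ i) then v else f j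

set-elim : ∀ {d} {A : Set} (Q : A → Set) (f : Fin d → A) i v j →
  (j ≡ i → Q v) → (j ≢ i → Q (f j)) → Q (set f i v j)
set-elim Q f i v j eq neq with j Fin.≟ i
... | yes j≡i = eq j≡i
... | no  j≢i = neq j≢i

set-elim₂ : ∀ {d} {A B : Set} (Q : A → B → Set) (f : Fin d → A) (g : Fin d → B) i v w j →
  (j ≡ i → Q v w) → (j ≢ i → Q (f j) (g j)) → Q (set f i v j) (set g i w j)
set-elim₂ Q f g i v w j eq neq with j Fin.≟ i
... | yes j≡i = eq j≡i
... | no  j≢i = neq j≢i

set-≡ : ∀ {d} {A : Set} (f : Fin d → A) i v → set f i v i ≡ v
set-≡ f i v = set-elim (_≡ v) f i v i (λ _ → refl) (λ i≢i → contradiction refl i≢i)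

set-≢ : ∀ {d} {A : Set} (f : Fin d → A) i v {j} → j ≢ i → set f i v j ≡ f j
set-≢ f i v {j} j≢i = set-elim (_≡ f j) f i v j (λ j≡i → contradiction j≡i j≢i) (λ _ → refl)

infixl 8 _∖_

-- Zeroing an entry keeps the index type, so several axes can be split off a sum one after another.
_∖_ : ∀ {n} → (Fin n → ℕ) → Fin n → Fin n → ℕ
f ∖ i = set f i 0

sum-split : ∀ {n} (f : Fin n → ℕ) i → ∑ f ≡ f i + ∑ (f ∖ i)
sum-split f zero    = refl
sum-split f (suc i) = trans (cong (f zero +_) (sum-split (f ∘ suc) i))
  (solve 3 (λ x y z → x :+ (y :+ z) := y :+ (x :+ z)) refl (f zero) (f (suc i)) _)

two-terms≤∑ : ∀ {n} (f : Fin n → ℕ) {i j} → j ≢ i → f i + f j ≤ ∑ f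
two-terms≤∑ f {i} {j} j≢i = ≤-trans
  (+-monoʳ-≤ (f i) (≤-trans (≤-reflexive (sym (set-≢ f i 0 j≢i))) (term≤∑ (f ∖ i) j)))
  (≤-reflexive (sym (sum-split f i)))

∖-mono : ∀ {n} {f g : Fin n → ℕ} i → (∀ j → j ≢ i → f j ≤ g j) → ∀ j → (f ∖ i) j ≤ (g ∖ i) j
∖-mono {f = f} {g} i f≤g j = set-elim₂ _≤_ f g i 0 0 j (λ _ → z≤n) (f≤g j)

sum-split₂ : ∀ {n} (f : Fin n → ℕ) {i j} → j ≢ i → ∑ f ≡ f i + f j + ∑ (f ∖ i ∖ j)
sum-split₂ f {i} {j} j≢i = trans (sum-split f i) (trans (cong (f i +_) (sum-split (f ∖ i) j))
  (trans (sym (+-assoc (f i) _ _)) (cong (λ x → f i + x + ∑ (f ∖ i ∖ j)) (set-≢ f i 0 j≢i))))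

sum-split₃ : ∀ {n} (f : Fin n → ℕ) {i j m} → j ≢ i → m ≢ i → m ≢ j → ∑ f ≡ f i + f j + f m + ∑ (f ∖ i ∖ j ∖ m)
sum-split₃ f {i} {j} {m} j≢i m≢i m≢j = trans (sum-split₂ f j≢i) (trans (cong (f i + f j +_) (sum-split (f ∖ i ∖ j) m))
  (trans (sym (+-assoc (f i + f j) _ _)) (cong (λ x → f i + f j + x + ∑ (f ∖ i ∖ j ∖ m))
    (trans (set-≢ (f ∖ i) j 0 m≢j) (set-≢ f i 0 m≢i)))))

argmax : ∀ {n} (f : Fin n → ℕ) → Fin n → ∃ λ i → ∀ j → f j ≤ f i
argmax {suc zero}    f _ = zero , λ { zero → ≤-refl }
argmax {suc (suc n)} f _ with argmax (f ∘ suc) zero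
... | i , max with f zero ≤? f (suc i)
... | yes p = suc i , λ { zero → p ; (suc j) → max j }
... | no ¬p = zero , λ { zero → ≤-refl ; (suc j) → ≤-trans (max j) (<⇒≤ (≰⇒> ¬p)) }

ind : ∀ {p} {P : Set p} → Dec P → ℕ
ind P? = if does P? then 1 else 0

ind-yes : ∀ {p} {P : Set p} (P? : Dec P) → P → ind P? ≡ 1
ind-yes P? p = cong (if_then 1 else 0) (dec-true P? p)

ind-no : ∀ {p} {P : Set p} (P? : Dec P) → ¬ P → ind P? ≡ 0
ind-no P? ¬p = cong (if_then 1 else 0) (dec-false P? ¬p)

ind≤1 : ∀ {p} {P : Set p} (P? : Dec P) → ind P? ≤ 1
ind≤1 (yes _) = ≤-refl
ind≤1 (no _)  = z≤n

sum-ind≤1 : ∀ {n p} {P : Fin n → Set p} (P? : ∀ x → Dec (P x)) →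
  (∀ {x y} → P x → P y → x ≡ y) → ∑ (λ x → ind (P? x)) ≤ 1
sum-ind≤1 {zero}  P? unique = z≤n
sum-ind≤1 {suc n} P? unique with P? zero
... | no  _ = sum-ind≤1 (P? ∘ suc) λ p q → Finₚ.suc-injective (unique p q)
... | yes p = s≤s (≤-reflexive (trans (sum-cong-≗ λ x → ind-no (P? (suc x)) λ q → Finₚ.0≢1+n (unique p q))
                                    (trans (sum-const n 0) (*-zeroʳ n))))

sum-ind-≟ : ∀ {n} (i : Fin n) → ∑ (λ j → ind (j Fin.≟ i)) ≡ 1
sum-ind-≟ i = ≤-antisym (sum-ind≤1 (Fin._≟ i) λ { refl refl → refl })
  (≤-trans (≤-reflexive (sym (ind-yes (i Fin.≟ i) refl))) (term≤∑ (λ j → ind (j Fin.≟ i)) i))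

sum-ind-≟-* : ∀ {n} (i : Fin n) a → ∑ (λ j → a * ind (j Fin.≟ i)) ≡ a
sum-ind-≟-* i a = trans (sym (*-distribˡ-sum a (λ j → ind (j Fin.≟ i)))) (trans (cong (a *_) (sum-ind-≟ i)) (*-identityʳ a))

In : ℕ → ℕ → ℕ → Set
In a b x = a ≤ x × x < b

In? : ∀ a b x → Dec (In a b x)
In? a b x = a ≤? x ×-dec x <? b

count-In≤∸ : ∀ n o a b → ∑ {n} (λ x → ind (In? a b (o + Fin.toℕ x))) ≤ b ∸ o
count-In≤∸ zero    o a b = z≤n
count-In≤∸ (suc n) o a b = begin
  ind (In? a b (o + 0)) + ∑ {n} (λ x → ind (In? a b (o + suc (Fin.toℕ x))))
    ≡⟨ cong₂ _+_ (cong (λ y → ind (In? a b y)) (+-identityʳ o)) (sum-cong-≗ {n} λ x → cong (λ y → ind (In? a b y)) (+-suc o (Fin.toℕ x))) ⟩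
  ind (In? a b o) + ∑ {n} (λ x → ind (In? a b (suc o + Fin.toℕ x)))
    ≤⟨ +-monoʳ-≤ (ind (In? a b o)) (count-In≤∸ n (suc o) a b) ⟩
  ind (In? a b o) + (b ∸ suc o)
    ≤⟨ first (In? a b o) ⟩
  b ∸ o ∎
  where
  open ≤-Reasoning
  first : (q : Dec (In a b o)) → ind q + (b ∸ suc o) ≤ b ∸ o
  first (yes (_ , o<b)) = ≤-reflexive (sym (+-∸-assoc 1 o<b))
  first (no _)          = ∸-monoʳ-≤ b (n≤1+n o)

-- The window of `n` points is shortened from the left until its start `o` is at least `a`; from
-- there on `count-In≤∸` gives at most `b ∸ o` points.
count-In≤length : ∀ n o a b → ∑ {n} (λ x → ind (In? a b (o + Fin.toℕ x))) ≤ b ∸ a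
count-In≤length zero    o a b = z≤n
count-In≤length (suc n) o a b with a ≤? o
... | yes a≤o = ≤-trans (count-In≤∸ (suc n) o a b) (∸-monoʳ-≤ b a≤o)
... | no  a≰o = begin
  ind (In? a b (o + 0)) + ∑ {n} (λ x → ind (In? a b (o + suc (Fin.toℕ x))))
    ≡⟨ cong₂ _+_ (ind-no (In? a b (o + 0)) (λ q → a≰o (subst (a ≤_) (+-identityʳ o) (proj₁ q))))
                 (sum-cong-≗ {n} λ x → cong (λ y → ind (In? a b y)) (+-suc o (Fin.toℕ x))) ⟩
  ∑ {n} (λ x → ind (In? a b (suc o + Fin.toℕ x)))
    ≤⟨ count-In≤length n (suc o) a b ⟩
  b ∸ a ∎
  where open ≤-Reasoning

-- Double counting of pairs of a point and an interval containing it: each of the `n` points lies in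
-- at least one interval, and an interval contains at most `b c ∸ a c` of them, also when it is
-- empty.
cover : ∀ {k} o n (a b : Fin k → ℕ) →
  (∀ x → o ≤ x → x < o + n → ∃ λ c → In (a c) (b c) x) → n ≤ ∑ (λ c → b c ∸ a c)
cover {k} o n a b covered = begin
  n                                       ≡⟨ trans (sym (*-identityʳ n)) (sym (sum-const n 1)) ⟩
  ∑ {n} (λ _ → 1)                       ≤⟨ sum-mono {n} hit ⟩
  ∑ {n} (λ x → ∑ {k} (λ c → F x c))   ≡⟨ ∑-comm {n} {k} F ⟩
  ∑ {k} (λ c → ∑ {n} (λ x → F x c))   ≤⟨ sum-mono {k} (λ c → count-In≤length n o (a c) (b c)) ⟩
  ∑ {k} (λ c → b c ∸ a c)               ∎
  where
  open ≤-Reasoning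
  F : Fin n → Fin k → ℕ
  F x c = ind (In? (a c) (b c) (o + Fin.toℕ x))
  hit : ∀ x → 1 ≤ ∑ (F x)
  hit x with covered (o + Fin.toℕ x) (m≤m+n o _) (+-monoʳ-< o (Finₚ.toℕ<n x))
  ... | c , inside = ≤-trans (≤-reflexive (sym (ind-yes (In? (a c) (b c) _) inside))) (term≤∑ (F x) c)

-- Saturated packings

-- The bricks [L c , U c] play the role of the maximal proper members below
-- a member [l , u] of a maximal system.
record Packing {d k : ℕ} (l u : Fin d → ℕ) (L U : Fin k → Fin d → ℕ) : Set where
  field
    ambient   : ∀ i → l i < u i
    brick     : ∀ c i → L c i < U c i
    inside    : ∀ c i → l i ≤ L c i × U c i ≤ u i
    proper    : ∀ c → ¬ (∀ i → L c i ≤ l i × u i ≤ U c i)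
    disjoint  : ∀ {c e} → c ≢ e → ∃ λ i → U c i < L e i ⊎ U e i < L c i
    -- A box that contains or avoids every child is compatible with the whole system, so maximality
    -- makes it a member, and a member inside [l , u] is full or lies in a child.
    saturated : ∀ (a b : Fin d → ℕ) → (∀ i → l i ≤ a i × a i < b i × b i ≤ u i) →
      (∀ c → (∀ i → a i ≤ L c i × U c i ≤ b i) ⊎ (∃ λ i → U c i < a i ⊎ b i < L c i)) →
      (∀ i → a i ≤ l i × u i ≤ b i) ⊎ (∃ λ c → ∀ i → L c i ≤ a i × b i ≤ U c i)

module PackingProperties {d k : ℕ} {l u : Fin d → ℕ} {L U : Fin k → Fin d → ℕ} (P : Packing l u L U) where
  open Packing P

  l≤L : ∀ c i → l i ≤ L c i
  l≤L c i = proj₁ (inside c i)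

  U≤u : ∀ c i → U c i ≤ u i
  U≤u c i = proj₂ (inside c i)

  overlap⇒≡ : ∀ c e → (∀ i → L e i ≤ U c i × L c i ≤ U e i) → c ≡ e
  overlap⇒≡ c e ov with c Fin.≟ e
  ... | yes c≡e = c≡e
  ... | no  c≢e with disjoint c≢e
  ... | i , inj₁ U<L = contradiction (proj₁ (ov i)) (<⇒≱ U<L)
  ... | i , inj₂ U<L = contradiction (proj₂ (ov i)) (<⇒≱ U<L)

  ⊆⇒≡ : ∀ c e → (∀ i → L e i ≤ L c i × U c i ≤ U e i) → c ≡ e
  ⊆⇒≡ c e sub = overlap⇒≡ c e λ i →
    ≤-trans (proj₁ (sub i)) (<⇒≤ (brick c i)) , ≤-trans (<⇒≤ (brick c i)) (proj₂ (sub i))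

  -- Side lengths minus 1, of [l , u] and of [L c , U c].
  α : Fin d → ℕ
  α i = u i ∸ suc (l i)

  γ : Fin k → Fin d → ℕ
  γ c i = U c i ∸ suc (L c i)

  s : Fin d → ℕ
  s i = ∑ (λ c → γ c i)

  u≡ : ∀ i → u i ≡ suc (l i + α i)
  u≡ i = sym (m+[n∸m]≡n (ambient i))

  U≡ : ∀ c i → U c i ≡ suc (L c i + γ c i)
  U≡ c i = sym (m+[n∸m]≡n (brick c i))

  AlmostFull : Fin d → Fin k → Set
  AlmostFull i c = ∀ j → j ≢ i → L c j ≡ l j × U c j ≡ u j

  AlmostFull? : ∀ i c → Dec (AlmostFull i c)
  AlmostFull? i c = all? λ j → ¬? (j Fin.≟ i) →-dec (L c j ≟ l j ×-dec U c j ≟ u j)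

  γ≤s : ∀ c i → γ c i ≤ s i
  γ≤s c i = term≤∑ (λ e → γ e i) c

  Spans : Fin d → Fin k → Set
  Spans i c = L c i ≡ l i × U c i ≡ u i

  spans⇒γ≡α : ∀ {i c} → Spans i c → γ c i ≡ α i
  spans⇒γ≡α (eq₁ , eq₂) = cong₂ (λ x y → x ∸ suc y) eq₂ eq₁

  Unspanned : Fin d → Set
  Unspanned i = ∀ c → ¬ Spans i c

  -- A brick spanning axis `i` would contribute `α i` to `s i` by itself.
  s<α⇒unspanned : ∀ i → s i < α i → Unspanned i
  s<α⇒unspanned i s<α c sp = <⇒≱ s<α (≤-trans (≤-reflexive (sym (spans⇒γ≡α sp))) (γ≤s c i))

  -- `thick` makes [l , u] larger than a unit cube, so the unit cubes along its edges are proper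
  -- sub-boxes and saturation says something about them.
  module Spread (spread : ∀ i c → ¬ AlmostFull i c) (i₀ : Fin d) (thick : suc (l i₀) < u i₀) where

    -- A box that meets no brick is compatible with all of them, so saturation would put it inside a
    -- brick, which it then meets.
    meet : ∀ (a b : Fin d → ℕ) → (∀ i → l i ≤ a i × a i < b i × b i ≤ u i) → ¬ (∀ i → a i ≤ l i × u i ≤ b i) →
      ∃ λ c → ∀ i → a i ≤ U c i × L c i ≤ b i
    meet a b box notFull with any? (λ c → all? λ i → a i ≤? U c i ×-dec L c i ≤? b i)
    ... | yes m = m
    ... | no ¬m with saturated a b box (λ c → inj₂ (apart c))
      where
      apart : ∀ c → ∃ λ i → U c i < a i ⊎ b i < L c i
      apart c with ¬∀⟶∃¬ d _ (λ i → a i ≤? U c i ×-dec L c i ≤? b i) (λ m → ¬m (c , m))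
      ... | i , ¬p with a i ≤? U c i
      ... | no  q = i , inj₁ (≰⇒> q)
      ... | yes q = i , inj₂ (≰⇒> (λ r → ¬p (q , r)))
    ... | inj₁ full = contradiction full notFull
    ... | inj₂ (c , sub) = c , λ i →
      ≤-trans (<⇒≤ (proj₁ (proj₂ (box i)))) (proj₂ (sub i)) , ≤-trans (proj₁ (sub i)) (<⇒≤ (proj₁ (proj₂ (box i))))

    -- The extension of `c` along `i` lies in no brick, since that brick would be `c` itself, and it
    -- is not full, since `c` would then be almost full. So it is not compatible with all bricks:
    -- some other brick `e` meets it. As `e` is disjoint from `c` but overlaps it on every other
    -- axis, the two are separated along `i`.
    grow : ∀ c i a′ b′ → l i ≤ a′ → a′ ≤ L c i → U c i ≤ b′ → b′ ≤ u i → a′ < L c i ⊎ U c i < b′ →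
      ∃ λ e → (∀ j → j ≢ i → L c j ≤ U e j × L e j ≤ U c j) ×
              ((a′ ≤ U e i × U e i < L c i) ⊎ (U c i < L e i × L e i ≤ b′))
    grow c i a′ b′ l≤a′ a′≤L U≤b′ b′≤u strict
      with any? (λ e → ¬? (e Fin.≟ c) ×-dec all? λ j → set (L c) i a′ j ≤? U e j ×-dec L e j ≤? set (U c) i b′ j)
    ... | yes (e , e≢c , m) = e , off , at (disjoint e≢c)
      where
      off : ∀ j → j ≢ i → L c j ≤ U e j × L e j ≤ U c j
      off j j≢i = subst (_≤ U e j) (set-≢ (L c) i a′ j≢i) (proj₁ (m j)) ,
                  subst (L e j ≤_) (set-≢ (U c) i b′ j≢i) (proj₂ (m j))
      at : (∃ λ j → U e j < L c j ⊎ U c j < L e j) → (a′ ≤ U e i × U e i < L c i) ⊎ (U c i < L e i × L e i ≤ b′)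
      at (j , sep) with j Fin.≟ i
      at (j , inj₁ lt) | yes refl = inj₁ (subst (_≤ U e i) (set-≡ (L c) i a′) (proj₁ (m i)) , lt)
      at (j , inj₂ lt) | yes refl = inj₂ (lt , subst (L e i ≤_) (set-≡ (U c) i b′) (proj₂ (m i)))
      at (j , inj₁ lt) | no j≢i = contradiction (proj₁ (off j j≢i)) (<⇒≱ lt)
      at (j , inj₂ lt) | no j≢i = contradiction (proj₂ (off j j≢i)) (<⇒≱ lt)
    ... | no ¬m with saturated (set (L c) i a′) (set (U c) i b′) box compatible
      where
      box : ∀ j → l j ≤ set (L c) i a′ j × set (L c) i a′ j < set (U c) i b′ j × set (U c) i b′ j ≤ u j
      box j = set-elim₂ (λ x y → l j ≤ x × x < y × y ≤ u j) (L c) (U c) i a′ b′ j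
        (λ { refl → l≤a′ , <-≤-trans (≤-<-trans a′≤L (brick c i)) U≤b′ , b′≤u })
        (λ _ → l≤L c j , brick c j , U≤u c j)
      compatible : ∀ e → (∀ j → set (L c) i a′ j ≤ L e j × U e j ≤ set (U c) i b′ j) ⊎
                         (∃ λ j → U e j < set (L c) i a′ j ⊎ set (U c) i b′ j < L e j)
      compatible e with e Fin.≟ c
      ... | yes refl = inj₁ λ j → set-elim₂ (λ x y → x ≤ L e j × U e j ≤ y) (L c) (U c) i a′ b′ j
            (λ { refl → a′≤L , U≤b′ }) (λ _ → ≤-refl , ≤-refl)
      ... | no e≢c with ¬∀⟶∃¬ d _ (λ j → set (L c) i a′ j ≤? U e j ×-dec L e j ≤? set (U c) i b′ j) (λ m → ¬m (e , e≢c , m))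
      ... | j , ¬p with set (L c) i a′ j ≤? U e j
      ... | no  q = inj₂ (j , inj₁ (≰⇒> q))
      ... | yes q = inj₂ (j , inj₂ (≰⇒> (λ r → ¬p (q , r))))
    ... | inj₁ full = contradiction almost (spread i c)
      where
      almost : AlmostFull i c
      almost j j≢i =
        ≤-antisym (subst (_≤ l j) (set-≢ (L c) i a′ j≢i) (proj₁ (full j))) (l≤L c j) ,
        ≤-antisym (U≤u c j) (subst (u j ≤_) (set-≢ (U c) i b′ j≢i) (proj₂ (full j)))
    ... | inj₂ (e , sub) = contradiction (⊆⇒≡ c e c⊆e) c≢e
      where
      c⊆e : ∀ j → L e j ≤ L c j × U c j ≤ U e j
      c⊆e j = ≤-trans (proj₁ (sub j)) (set-elim (_≤ L c j) (L c) i a′ j (λ { refl → a′≤L }) (λ _ → ≤-refl)) ,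
              ≤-trans (set-elim (U c j ≤_) (U c) i b′ j (λ { refl → U≤b′ }) (λ _ → ≤-refl)) (proj₂ (sub j))
      c≢e : c ≢ e
      c≢e refl = [ (λ lt → <⇒≱ lt (subst (L c i ≤_) (set-≡ (L c) i a′) (proj₁ (sub i))))
                 , (λ lt → <⇒≱ lt (subst (_≤ U c i) (set-≡ (U c) i b′) (proj₂ (sub i)))) ]′ strict

    -- The brick blocking the growth of `c` down to `l i` would have to end before `suc (l i)`,
    -- which leaves no room for a positive length.
    L≢1+l : ∀ c i → L c i ≢ suc (l i)
    L≢1+l c i eq with grow c i (l i) (U c i) ≤-refl (l≤L c i) ≤-refl (U≤u c i) (inj₁ (≤-reflexive (sym eq)))
    ... | e , _ , inj₁ (_ , U<L) = <⇒≱ (≤-<-trans (l≤L e i) (brick e i)) (≤-pred (subst (U e i <_) eq U<L))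
    ... | e , _ , inj₂ (U<L , L≤U) = <⇒≱ U<L L≤U

    1+U≢u : ∀ c i → suc (U c i) ≢ u i
    1+U≢u c i eq with grow c i (L c i) (u i) (l≤L c i) ≤-refl (U≤u c i) ≤-refl (inj₂ (≤-reflexive eq))
    ... | e , _ , inj₁ (L≤U , U<L) = <⇒≱ U<L L≤U
    ... | e , _ , inj₂ (U<L , _) = <⇒≱ (<-≤-trans (brick e i) (U≤u e i)) (subst (_≤ L e i) eq U<L)

    Pinned : Bool → Fin d → Fin k → Set
    Pinned false i c = L c i ≡ l i
    Pinned true  i c = U c i ≡ u i

    Pinned? : ∀ b i c → Dec (Pinned b i c)
    Pinned? false i c = L c i ≟ l i
    Pinned? true  i c = U c i ≟ u i

    L≤1+l⇒pinned : ∀ c i → L c i ≤ suc (l i) → Pinned false i c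
    L≤1+l⇒pinned c i le with m≤n⇒m<n∨m≡n le
    ... | inj₁ lt = ≤-antisym (≤-pred lt) (l≤L c i)
    ... | inj₂ eq = contradiction eq (L≢1+l c i)

    u≤1+U⇒pinned : ∀ c i → u i ≤ suc (U c i) → Pinned true i c
    u≤1+U⇒pinned c i le with m≤n⇒m<n∨m≡n le
    ... | inj₁ lt = ≤-antisym (U≤u c i) (≤-pred lt)
    ... | inj₂ eq = contradiction (sym eq) (1+U≢u c i)

    pinned-overlap : ∀ b i {c e} → Pinned b i c → Pinned b i e → L e i ≤ U c i × L c i ≤ U e i
    pinned-overlap false i {c} {e} p q =
      ≤-trans (≤-reflexive (trans q (sym p))) (<⇒≤ (brick c i)) , ≤-trans (≤-reflexive (trans p (sym q))) (<⇒≤ (brick e i))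
    pinned-overlap true i {c} {e} p q =
      ≤-trans (<⇒≤ (brick e i)) (≤-reflexive (trans q (sym p))) , ≤-trans (<⇒≤ (brick c i)) (≤-reflexive (trans p (sym q)))

    -- σ selects a vertex of [l , u], with true for the upper end of an axis.
    OnEdge : (Fin d → Bool) → Fin d → Fin k → Set
    OnEdge σ i c = ∀ j → j ≢ i → Pinned (σ j) j c

    cubeLow cubeHigh : (Fin d → Bool) → Fin d → ℕ
    cubeLow  σ j = if σ j then pred (u j) else l j
    cubeHigh σ j = if σ j then u j else suc (l j)

    1+pred-u : ∀ j → suc (pred (u j)) ≡ u j
    1+pred-u j = suc-pred (u j) ⦃ >-nonZero (≤-<-trans z≤n (ambient j)) ⦄

    cube-unit : ∀ σ j → cubeHigh σ j ≡ suc (cubeLow σ j)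
    cube-unit σ j with σ j
    ... | true  = sym (1+pred-u j)
    ... | false = refl

    cube-inside : ∀ σ j → l j ≤ cubeLow σ j × cubeHigh σ j ≤ u j
    cube-inside σ j with σ j
    ... | true  = ≤-pred (≤-trans (ambient j) (≤-reflexive (sym (1+pred-u j)))) , ≤-refl
    ... | false = ≤-refl , ambient j

    -- Meeting the corner cube puts the brick within distance 1 of the facet, and distance exactly 1
    -- is excluded by `L≢1+l` and `1+U≢u`.
    meets-cube⇒pinned : ∀ σ j c → cubeLow σ j ≤ U c j → L c j ≤ cubeHigh σ j → Pinned (σ j) j c
    meets-cube⇒pinned σ j c p q with σ j
    ... | true  = u≤1+U⇒pinned c j (≤-trans (≤-reflexive (sym (1+pred-u j))) (s≤s p))
    ... | false = L≤1+l⇒pinned c j q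

    -- `meet` is applied to the unit cube at position `x` of the edge, and `meets-cube⇒pinned` pins
    -- the brick on all other axes. Along `i` the contact may be a single boundary point, which
    -- accounts for the weak bounds.
    edge-meet : ∀ σ i x → l i ≤ x → x < u i → ∃ λ c → OnEdge σ i c × L c i ≤ suc x × x ≤ U c i
    edge-meet σ i x l≤x x<u = c , onEdge ,
      subst (L c i ≤_) (set-≡ (cubeHigh σ) i (suc x)) (proj₂ (m i)) , subst (_≤ U c i) (set-≡ (cubeLow σ) i x) (proj₁ (m i))
      where
      a b : Fin d → ℕ
      a = set (cubeLow σ) i x
      b = set (cubeHigh σ) i (suc x)
      box : ∀ j → l j ≤ a j × a j < b j × b j ≤ u j
      box j = set-elim₂ (λ a b → l j ≤ a × a < b × b ≤ u j) (cubeLow σ) (cubeHigh σ) i x (suc x) j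
        (λ { refl → l≤x , ≤-refl , x<u })
        (λ _ → proj₁ (cube-inside σ j) , ≤-reflexive (sym (cube-unit σ j)) , proj₂ (cube-inside σ j))
      unit₀ : b i₀ ≡ suc (a i₀)
      unit₀ = set-elim₂ (λ a b → b ≡ suc a) (cubeLow σ) (cubeHigh σ) i x (suc x) i₀ (λ _ → refl) (λ _ → cube-unit σ i₀)
      notFull : ¬ (∀ j → a j ≤ l j × u j ≤ b j)
      notFull full = <⇒≱ thick (≤-trans (proj₂ (full i₀)) (≤-trans (≤-reflexive unit₀) (s≤s (proj₁ (full i₀)))))
      met = meet a b box notFull
      c = proj₁ met
      m = proj₂ met
      onEdge : OnEdge σ i c
      onEdge j j≢i = meets-cube⇒pinned σ j c
        (subst (_≤ U c j) (set-≢ (cubeLow σ) i x j≢i) (proj₁ (m j)))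
        (subst (L c j ≤_) (set-≢ (cubeHigh σ) i (suc x) j≢i) (proj₂ (m j)))

    -- A slab that no brick crosses divides the bricks into those before and those after it. Cutting
    -- [l , u] there gives a box compatible with all bricks, hence inside a brick, and that brick
    -- would be almost full.
    no-gap : ∀ i x → l i ≤ x → x < u i → ∃ λ c → L c i ≤ x × x < U c i
    no-gap i x l≤x x<u with any? (λ c → L c i ≤? x ×-dec x <? U c i)
    ... | yes found = found
    ... | no none = contradiction impossible (λ ())
      where
      side : ∀ c → U c i ≤ x ⊎ x < L c i
      side c with L c i ≤? x
      ... | no  q = inj₂ (≰⇒> q)
      ... | yes q = inj₁ (≮⇒≥ (λ r → none (c , q , r)))
      impossible : ⊥
      impossible with m≤n⇒m<n∨m≡n l≤x
      -- The part of the box below `x` contains the bricks ending by `x` and avoids the others,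
      -- which start at `suc x` or later.
      impossible | inj₁ l<x with saturated l (set u i x) box compatible
        where
        box : ∀ j → l j ≤ l j × l j < set u i x j × set u i x j ≤ u j
        box j = ≤-refl , set-elim (λ b → l j < b × b ≤ u j) u i x j (λ { refl → l<x , <⇒≤ x<u }) (λ _ → ambient j , ≤-refl)
        compatible : ∀ c → (∀ j → l j ≤ L c j × U c j ≤ set u i x j) ⊎ (∃ λ j → U c j < l j ⊎ set u i x j < L c j)
        compatible c with side c
        ... | inj₁ le = inj₁ λ j → l≤L c j , set-elim (U c j ≤_) u i x j (λ { refl → le }) (λ _ → U≤u c j)
        ... | inj₂ lt = inj₂ (i , inj₂ (subst (_< L c i) (sym (set-≡ u i x)) lt))
      ... | inj₁ full = <⇒≱ x<u (subst (u i ≤_) (set-≡ u i x) (proj₂ (full i)))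
      ... | inj₂ (c , sub) = spread i c λ j j≢i →
        ≤-antisym (proj₁ (sub j)) (l≤L c j) , ≤-antisym (U≤u c j) (subst (_≤ U c j) (set-≢ u i x j≢i) (proj₂ (sub j)))
      impossible | inj₂ refl with m≤n⇒m<n∨m≡n x<u
      impossible | inj₂ refl | inj₂ 1+l≡u with edge-meet (λ _ → false) i x ≤-refl x<u
      ... | c , _ with side c
      ... | inj₁ le = <⇒≱ (brick c i) (≤-trans le (l≤L c i))
      ... | inj₂ lt = <⇒≱ (brick c i) (≤-trans (U≤u c i) (≤-trans (≤-reflexive (sym 1+l≡u)) lt))
      -- The uncrossed slab is the first one, so every brick lies in the box that starts at
      -- `suc (l i)`.
      impossible | inj₂ refl | inj₁ 1+l<u with saturated (set l i (suc (l i))) u box compatible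
        where
        box : ∀ j → l j ≤ set l i (suc (l i)) j × set l i (suc (l i)) j < u j × u j ≤ u j
        box j = set-elim (λ a → l j ≤ a × a < u j × u j ≤ u j) l i (suc (l i)) j
          (λ { refl → n≤1+n _ , 1+l<u , ≤-refl }) (λ _ → ≤-refl , ambient j , ≤-refl)
        compatible : ∀ c → (∀ j → set l i (suc (l i)) j ≤ L c j × U c j ≤ u j) ⊎ (∃ λ j → U c j < set l i (suc (l i)) j ⊎ u j < L c j)
        compatible c with side c
        ... | inj₁ le = contradiction (≤-trans le (l≤L c i)) (<⇒≱ (brick c i))
        ... | inj₂ lt = inj₁ λ j → set-elim (_≤ L c j) l i (suc (l i)) j (λ { refl → lt }) (λ _ → l≤L c j) , U≤u c j
      ... | inj₁ full = <⇒≱ (n<1+n (l i)) (subst (_≤ l i) (set-≡ l i (suc (l i))) (proj₁ (full i)))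
      ... | inj₂ (c , sub) = spread i c λ j j≢i →
        ≤-antisym (subst (L c j ≤_) (set-≢ l i (suc (l i)) j≢i) (proj₁ (sub j))) (l≤L c j) , ≤-antisym (U≤u c j) (proj₂ (sub j))

-- Counting along edges and rims

-- A brick touches two of the four edges of a 2-face only at a common corner.
edges≤face+corners : ∀ {F A B C D : Set} (F? : Dec F) (A? : Dec A) (B? : Dec B) (C? : Dec C) (D? : Dec D) →
  ¬ (A × B) → ¬ (C × D) →
  ind (F? ×-dec A?) + ind (F? ×-dec B?) + ind (F? ×-dec C?) + ind (F? ×-dec D?) ≤
  ind (F? ×-dec ((A? ⊎-dec B?) ⊎-dec (C? ⊎-dec D?))) +
  (ind (F? ×-dec (A? ×-dec C?)) + ind (F? ×-dec (A? ×-dec D?)) +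
   ind (F? ×-dec (B? ×-dec C?)) + ind (F? ×-dec (B? ×-dec D?)))
edges≤face+corners (no _)  _       _       _       _       ¬AB ¬CD = z≤n
edges≤face+corners (yes _) (yes a) (yes b) _       _       ¬AB ¬CD = contradiction (a , b) ¬AB
edges≤face+corners (yes _) _       _       (yes c) (yes d) ¬AB ¬CD = contradiction (c , d) ¬CD
edges≤face+corners (yes _) (yes _) (no _)  (yes _) (no _)  ¬AB ¬CD = ≤-refl
edges≤face+corners (yes _) (yes _) (no _)  (no _)  (yes _) ¬AB ¬CD = ≤-refl
edges≤face+corners (yes _) (yes _) (no _)  (no _)  (no _)  ¬AB ¬CD = ≤-refl
edges≤face+corners (yes _) (no _)  (yes _) (yes _) (no _)  ¬AB ¬CD = ≤-refl
edges≤face+corners (yes _) (no _)  (yes _) (no _)  (yes _) ¬AB ¬CD = ≤-refl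
edges≤face+corners (yes _) (no _)  (yes _) (no _)  (no _)  ¬AB ¬CD = ≤-refl
edges≤face+corners (yes _) (no _)  (no _)  (yes _) (no _)  ¬AB ¬CD = ≤-refl
edges≤face+corners (yes _) (no _)  (no _)  (no _)  (yes _) ¬AB ¬CD = ≤-refl
edges≤face+corners (yes _) (no _)  (no _)  (no _)  (no _)  ¬AB ¬CD = ≤-refl

sum-+₃ : ∀ {n} (f g h : Fin n → ℕ) → ∑ (λ c → f c + g c + h c) ≡ ∑ f + ∑ g + ∑ h
sum-+₃ f g h = trans (∑-distrib-+ (λ c → f c + g c) h) (cong (_+ ∑ h) (∑-distrib-+ f g))

sum-+₄ : ∀ {n} (f g h r : Fin n → ℕ) → ∑ (λ c → f c + g c + h c + r c) ≡ ∑ f + ∑ g + ∑ h + ∑ r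
sum-+₄ f g h r = trans (∑-distrib-+ (λ c → f c + g c + h c) r) (cong (_+ ∑ r) (sum-+₃ f g h))

module Counting {d k : ℕ} {l u : Fin d → ℕ} {L U : Fin k → Fin d → ℕ} (P : Packing l u L U) (spread : ∀ i c → ¬ PackingProperties.AlmostFull P i c) (i₀ : Fin d) (thick : suc (l i₀) < u i₀) where
  open Packing P
  open PackingProperties P
  open Spread spread i₀ thick

  -- Here h is the largest gap length allowed between consecutive bricks: the
  -- half-open intervals [L c , U c + h) then cover [l , u + h).
  tally : ∀ i h {Q : Fin k → Set} (Q? : ∀ c → Dec (Q c)) →
    (∀ x → l i ≤ x → x < u i + h → ∃ λ c → Q c × L c i ≤ x × x < U c i + h) →
    α i + suc h ≤ s i + suc h * ∑ (λ c → ind (Q? c))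
  tally i h Q? covered = begin
    α i + suc h
      ≤⟨ cover (l i) (α i + suc h) (λ c → L c i) (λ c → L c i + ind (Q? c) * (γ c i + suc h)) covered′ ⟩
    ∑ (λ c → L c i + ind (Q? c) * (γ c i + suc h) ∸ L c i)
      ≤⟨ sum-mono {k} weight ⟩
    ∑ (λ c → γ c i + suc h * ind (Q? c))
      ≡⟨ ∑-distrib-+ {k} (λ c → γ c i) (λ c → suc h * ind (Q? c)) ⟩
    s i + ∑ (λ c → suc h * ind (Q? c))
      ≡⟨ cong (s i +_) (sym (*-distribˡ-sum {k} (suc h) (λ c → ind (Q? c)))) ⟩
    s i + suc h * ∑ (λ c → ind (Q? c)) ∎
    where
    open ≤-Reasoning
    weight : ∀ c → L c i + ind (Q? c) * (γ c i + suc h) ∸ L c i ≤ γ c i + suc h * ind (Q? c)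
    weight c = ≤-trans (≤-reflexive (m+n∸m≡n (L c i) _)) (weight′ (Q? c))
      where
      weight′ : ∀ {A : Set} (A? : Dec A) → ind A? * (γ c i + suc h) ≤ γ c i + suc h * ind A?
      weight′ (yes _) = ≤-reflexive (trans (+-identityʳ _) (cong (γ c i +_) (sym (*-identityʳ (suc h)))))
      weight′ (no _)  = z≤n
    covered′ : ∀ x → l i ≤ x → x < l i + (α i + suc h) → ∃ λ c → In (L c i) (L c i + ind (Q? c) * (γ c i + suc h)) x
    covered′ x l≤x x< with covered x l≤x (≤-trans x< (≤-reflexive
      (trans (solve 3 (λ a b c → a :+ (b :+ (con 1 :+ c)) := con 1 :+ (a :+ b) :+ c) refl (l i) (α i) h) (cong (_+ h) (sym (u≡ i))))))
    ... | c , q , L≤x , x<U = c , L≤x , ≤-trans x<U (≤-reflexive (trans (cong (_+ h) (U≡ c i))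
      (trans (solve 3 (λ a b c → con 1 :+ (a :+ b) :+ c := a :+ con 1 :* (b :+ (con 1 :+ c))) refl (L c i) (γ c i) h)
             (cong (λ y → L c i + y * (γ c i + suc h)) (sym (ind-yes (Q? c) q))))))

  -- By `no-gap` the bricks leave no gap along `i`, so `h` is 0. The equation `L c i ≡ L c i` serves
  -- as a decidable predicate that holds for all bricks.
  slab-tally : ∀ i → α i + 1 ≤ s i + k
  slab-tally i = ≤-trans (tally i 0 {Q = λ c → L c i ≡ L c i} (λ c → L c i ≟ L c i) covered)
    (+-monoʳ-≤ (s i) (≤-trans (≤-reflexive (+-identityʳ _))
      (≤-trans (sum-mono {k} (λ c → ind≤1 (L c i ≟ L c i))) (≤-reflexive (trans (sum-const k 1) (*-identityʳ k))))))
    where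
    covered : ∀ x → l i ≤ x → x < u i + 0 → ∃ λ c → L c i ≡ L c i × L c i ≤ x × x < U c i + 0
    covered x l≤x x<u with no-gap i x l≤x (≤-trans x<u (≤-reflexive (+-identityʳ _)))
    ... | c , L≤x , x<U = c , refl , L≤x , ≤-trans x<U (≤-reflexive (sym (+-identityʳ _)))

  -- The brick found at the cell starting at `y` begins by `suc y` and ends at `y` or later, so its
  -- extension by 2 contains `suc y`. At the two ends of the edge the brick found touches the end of
  -- the axis, which covers the remaining points.
  edge-tally : ∀ σ i {Q : Fin k → Set} (Q? : ∀ c → Dec (Q c)) → (∀ c → OnEdge σ i c → Q c) →
    α i + 3 ≤ s i + 3 * ∑ (λ c → ind (Q? c))
  edge-tally σ i Q? onEdge⇒Q = tally i 2 Q? covered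
    where
    Covered : ℕ → Set
    Covered x = ∃ λ c → _ × L c i ≤ x × x < U c i + 2
    covered : ∀ x → l i ≤ x → x < u i + 2 → Covered x
    covered x l≤x x<u+2 with m≤n⇒m<n∨m≡n l≤x
    ... | inj₂ refl with edge-meet σ i x ≤-refl (ambient i)
    ... | c , e , L≤ , _ = c , onEdge⇒Q c e , ≤-reflexive (L≤1+l⇒pinned c i L≤) ,
          ≤-trans (≤-<-trans (l≤L c i) (brick c i)) (m≤m+n _ 2)
    covered (suc y) _ x<u+2 | inj₁ (s≤s l≤y) with y <? u i
    ... | yes y<u with edge-meet σ i y l≤y y<u
    ... | c , e , L≤ , y≤U = c , onEdge⇒Q c e , L≤ , ≤-trans (s≤s (s≤s y≤U)) (≤-reflexive (+-comm 2 _))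
    covered (suc y) _ x<u+2 | inj₁ _ | no y≮u with edge-meet σ i (pred (u i)) (≤-pred (≤-trans (ambient i) (≤-reflexive (sym (1+pred-u i))))) (≤-reflexive (1+pred-u i))
    ... | c , e , L≤ , u-1≤U = c , onEdge⇒Q c e ,
          ≤-trans (≤-trans L≤ (≤-reflexive (1+pred-u i))) (≤-trans (≮⇒≥ y≮u) (n≤1+n y)) ,
          ≤-trans x<u+2 (+-monoˡ-≤ 2 (≤-reflexive (sym (u≤1+U⇒pinned c i (≤-trans (≤-reflexive (sym (1+pred-u i))) (s≤s u-1≤U))))))

  -- For bricks touching facet `b` of axis `i`: `e` reaches less far into [l , u] than `c`.
  Shallower : Bool → Fin d → Fin k → Fin k → Set
  Shallower false i e c = U e i < U c i
  Shallower true  i e c = L c i < L e i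

  Shallower-asym : ∀ b i {c e} → Shallower b i e c → ¬ Shallower b i c e
  Shallower-asym false i = <-asym
  Shallower-asym true  i = <-asym

  -- As `e` touches the facet, a brick `f` separated from `e` along `i` lies beyond it, and `c`
  -- reaches far enough to overlap `f`.
  shallower : ∀ b i {c e f} → Pinned b i c → Pinned b i e → L c i ≤ U f i × L f i ≤ U c i →
    U f i < L e i ⊎ U e i < L f i → Shallower b i e c
  shallower false i {c} {e} {f} _ q (_ , Lf≤Uc) (inj₁ lt) =
    contradiction (≤-trans (≤-reflexive q) (≤-trans (l≤L f i) (<⇒≤ (brick f i)))) (<⇒≱ lt)
  shallower false i _ _ (_ , Lf≤Uc) (inj₂ lt) = <-≤-trans lt Lf≤Uc
  shallower true  i _ _ (Lc≤Uf , _) (inj₁ lt) = ≤-<-trans Lc≤Uf lt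
  shallower true  i {c} {e} {f} _ q _ (inj₂ lt) =
    contradiction (≤-trans (<⇒≤ (brick f i)) (≤-trans (U≤u f i) (≤-reflexive (sym q)))) (<⇒≱ lt)

  flat⇒overlap : ∀ {j} → α j ≡ 0 → ∀ c e → ¬ (U c j < L e j ⊎ U e j < L c j)
  flat⇒overlap {j} α≡0 c e (inj₁ lt) =
    <⇒≱ (≤-<-trans (≤-<-trans (l≤L c j) (brick c j)) (<-≤-trans (<-trans lt (brick e j)) (U≤u e j)))
      (≤-reflexive (trans (u≡ j) (cong suc (trans (cong (l j +_) α≡0) (+-identityʳ _)))))
  flat⇒overlap α≡0 c e (inj₂ lt) = flat⇒overlap α≡0 e c (inj₁ lt)

  -- An uncovered point x of an edge lies between a brick c ending at x - 1 and
  -- a brick e starting at x + 1.  The bricks blocking the growth of c and of e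
  -- towards x show that each of c and e is shallower than the other.
  edge-covered : ∀ σ i o → i ≢ o → (∀ j → j ≢ i → j ≢ o → α j ≡ 0) → ∀ x → l i ≤ x → x ≤ u i →
    ∃ λ c → OnEdge σ i c × L c i ≤ x × x ≤ U c i
  edge-covered σ i o i≢o flat x l≤x x≤u with m≤n⇒m<n∨m≡n l≤x
  ... | inj₂ refl with edge-meet σ i x ≤-refl (ambient i)
  ... | c , e , L≤ , l≤U = c , e , ≤-reflexive (L≤1+l⇒pinned c i L≤) , l≤U
  edge-covered σ i o i≢o flat (suc y) _ y<u | inj₁ (s≤s l≤y) with edge-meet σ i y l≤y y<u | m≤n⇒m<n∨m≡n y<u
  ... | c , onC , L≤ , y≤U | inj₂ 1+y≡u = c , onC , L≤ ,
        ≤-reflexive (trans 1+y≡u (sym (u≤1+U⇒pinned c i (≤-trans (≤-reflexive (sym 1+y≡u)) (s≤s y≤U)))))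
  ... | c , onC , L≤ , y≤U | inj₁ x<u with edge-meet σ i (suc y) (≤-trans l≤y (n≤1+n y)) x<u
  ... | e , onE , L≤′ , x≤U′ with m≤n⇒m<n∨m≡n y≤U | m≤n⇒m<n∨m≡n L≤′
  ... | inj₁ x≤U | _ = c , onC , L≤ , x≤U
  ... | inj₂ _ | inj₁ (s≤s L′≤x) = e , onE , L′≤x , x≤U′
  ... | inj₂ y≡U | inj₂ L′≡2+y = contradiction (c<e right left) (Shallower-asym (σ o) o {c} {e} (e<c right left))
    where
    pinC : Pinned (σ o) o c
    pinC = onC o (i≢o ∘ sym)
    pinE : Pinned (σ o) o e
    pinE = onE o (i≢o ∘ sym)
    Right Left : Set
    Right = ∃ λ f → (∀ j → j ≢ i → L c j ≤ U f j × L f j ≤ U c j) ×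
      ((L c i ≤ U f i × U f i < L c i) ⊎ (U c i < L f i × L f i ≤ suc y))
    Left = ∃ λ f → (∀ j → j ≢ i → L e j ≤ U f j × L f j ≤ U e j) ×
      ((suc y ≤ U f i × U f i < L e i) ⊎ (U e i < L f i × L f i ≤ U e i))
    right : Right
    right = grow c i (L c i) (suc y) (l≤L c i) ≤-refl (≤-trans (≤-reflexive (sym y≡U)) (n≤1+n y)) y<u (inj₂ (≤-reflexive (cong suc (sym y≡U))))
    left : Left
    left = grow e i (suc y) (U e i) (≤-trans l≤y (n≤1+n y)) (≤-trans (n≤1+n _) (≤-reflexive (sym L′≡2+y))) ≤-refl (U≤u e i) (inj₁ (≤-reflexive (sym L′≡2+y)))
    e<c : Right → Left → Shallower (σ o) o e c
    e<c (f , _ , inj₁ (p , q)) _ = contradiction p (<⇒≱ q)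
    -- `f` starts at `suc y` and so reaches `L e i`: it is not separated from `e` along `i`. On the
    -- axes of length 1 all bricks overlap, so only `o` can separate them.
    e<c (f , off , inj₂ (p , q)) _ with disjoint {f} {e} (λ { refl → <⇒≱ (≤-reflexive (sym L′≡2+y)) q })
    ... | j , sep with j Fin.≟ i | j Fin.≟ o
    ... | yes refl | _ = contradiction sep λ
          { (inj₁ lt) → <⇒≱ (brick f i) (≤-trans (≤-pred (≤-trans lt (≤-reflexive L′≡2+y))) (≤-trans (s≤s (≤-reflexive y≡U)) p))
          ; (inj₂ lt) → <⇒≱ lt (≤-trans q x≤U′) }
    ... | no _ | yes refl = shallower (σ o) o {c} {e} {f} pinC pinE (off o (i≢o ∘ sym)) sep
    ... | no j≢i | no j≢o = contradiction sep (flat⇒overlap (flat j j≢i j≢o) f e)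
    c<e : Right → Left → Shallower (σ o) o c e
    c<e _ (f , _ , inj₂ (p , q)) = contradiction q (<⇒≱ p)
    c<e _ (f , off , inj₁ (p , q)) with disjoint {f} {c} (λ { refl → <⇒≱ (s≤s (≤-reflexive (sym y≡U))) p })
    ... | j , sep with j Fin.≟ i | j Fin.≟ o
    ... | yes refl | _ = contradiction sep λ
          { (inj₁ lt) → <⇒≱ (<-trans lt (brick c i)) (≤-trans (≤-reflexive (sym y≡U)) (≤-trans (n≤1+n y) p))
          ; (inj₂ lt) → <⇒≱ (brick f i) (≤-trans (≤-pred (≤-trans q (≤-reflexive L′≡2+y))) (≤-trans (s≤s (≤-reflexive y≡U)) lt)) }
    ... | no _ | yes refl = shallower (σ o) o {e} {c} {f} pinE pinC (off o (i≢o ∘ sym)) sep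
    ... | no j≢i | no j≢o = contradiction sep (flat⇒overlap (flat j j≢i j≢o) f c)

  -- By `edge-covered` every lattice point of the edge lies in a closed brick on the edge, so an
  -- extension by 1 suffices where `edge-tally` takes 2.
  flat-edge-tally : ∀ σ i o → i ≢ o → (∀ j → j ≢ i → j ≢ o → α j ≡ 0) →
    {Q : Fin k → Set} (Q? : ∀ c → Dec (Q c)) → (∀ c → OnEdge σ i c → Q c) →
    α i + 2 ≤ s i + 2 * ∑ (λ c → ind (Q? c))
  flat-edge-tally σ i o i≢o flat Q? onEdge⇒Q = tally i 1 Q? λ x l≤x x<u+1 →
    let c , e , L≤x , x≤U = edge-covered σ i o i≢o flat x l≤x (≤-pred (≤-trans x<u+1 (≤-reflexive (+-comm _ 1))))
    in c , onEdge⇒Q c e , L≤x , ≤-trans (s≤s x≤U) (≤-reflexive (+-comm 1 _))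

  -- Two-dimensional faces and their rims

  module TwoFace (i₁ i₂ : Fin d) (i₁≢i₂ : i₁ ≢ i₂) (unspanned₁ : Unspanned i₁) (unspanned₂ : Unspanned i₂) where

    OnFace : (Fin d → Bool) → Fin k → Set
    OnFace σ c = ∀ j → j ≢ i₁ → j ≢ i₂ → Pinned (σ j) j c

    OnFace? : ∀ σ c → Dec (OnFace σ c)
    OnFace? σ c = all? λ j → ¬? (j Fin.≟ i₁) →-dec (¬? (j Fin.≟ i₂) →-dec Pinned? (σ j) j c)

    OnRim : (Fin d → Bool) → Fin k → Set
    OnRim σ c = OnFace σ c × ((Pinned false i₁ c ⊎ Pinned true i₁ c) ⊎ (Pinned false i₂ c ⊎ Pinned true i₂ c))

    OnRim? : ∀ σ c → Dec (OnRim σ c)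
    OnRim? σ c = OnFace? σ c ×-dec ((Pinned? false i₁ c ⊎-dec Pinned? true i₁ c) ⊎-dec (Pinned? false i₂ c ⊎-dec Pinned? true i₂ c))

    rim : (Fin d → Bool) → ℕ
    rim σ = ∑ (λ c → ind (OnRim? σ c))

    -- Counts the bricks on the rim edge where coordinate `i` is fixed at side `b`; that edge runs
    -- in the direction of the other one of `i₁` and `i₂`.
    edge : (Fin d → Bool) → Bool → Fin d → ℕ
    edge σ b i = ∑ (λ c → ind (OnFace? σ c ×-dec Pinned? b i c))

    corner≤1 : ∀ σ b₁ b₂ → ∑ (λ c → ind (OnFace? σ c ×-dec (Pinned? b₁ i₁ c ×-dec Pinned? b₂ i₂ c))) ≤ 1
    corner≤1 σ b₁ b₂ = sum-ind≤1 (λ c → OnFace? σ c ×-dec (Pinned? b₁ i₁ c ×-dec Pinned? b₂ i₂ c)) unique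
      where
      unique : ∀ {c e} → OnFace σ c × Pinned b₁ i₁ c × Pinned b₂ i₂ c → OnFace σ e × Pinned b₁ i₁ e × Pinned b₂ i₂ e → c ≡ e
      unique {c} {e} (f , p , q) (f′ , p′ , q′) = overlap⇒≡ c e shared
        where
        shared : ∀ j → L e j ≤ U c j × L c j ≤ U e j
        shared j with j Fin.≟ i₁ | j Fin.≟ i₂
        ... | yes refl | _        = pinned-overlap b₁ j {c} {e} p p′
        ... | no _     | yes refl = pinned-overlap b₂ j {c} {e} q q′
        ... | no j≢i₁  | no j≢i₂  = pinned-overlap (σ j) j {c} {e} (f j j≢i₁ j≢i₂) (f′ j j≢i₁ j≢i₂)

    -- Only corner bricks are counted twice, and each of the four corners has at most one.
    edges≤rim+4 : ∀ σ → edge σ false i₁ + edge σ true i₁ + edge σ false i₂ + edge σ true i₂ ≤ rim σ + 4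
    edges≤rim+4 σ = begin
      edge σ false i₁ + edge σ true i₁ + edge σ false i₂ + edge σ true i₂
        ≡⟨ sum-+₄ {k} (E false i₁) (E true i₁) (E false i₂) (E true i₂) ⟨
      ∑ (λ c → E false i₁ c + E true i₁ c + E false i₂ c + E true i₂ c)
        ≤⟨ sum-mono {k} (λ c → edges≤face+corners (OnFace? σ c) (Pinned? false i₁ c) (Pinned? true i₁ c) (Pinned? false i₂ c) (Pinned? true i₂ c) (unspanned₁ c) (unspanned₂ c)) ⟩
      ∑ (λ c → ind (OnRim? σ c) + (K false false c + K false true c + K true false c + K true true c))
        ≡⟨ ∑-distrib-+ {k} (λ c → ind (OnRim? σ c)) (λ c → K false false c + K false true c + K true false c + K true true c) ⟩
      rim σ + ∑ (λ c → K false false c + K false true c + K true false c + K true true c)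
        ≡⟨ cong (rim σ +_) (sum-+₄ {k} (K false false) (K false true) (K true false) (K true true)) ⟩
      rim σ + (∑ (K false false) + ∑ (K false true) + ∑ (K true false) + ∑ (K true true))
        ≤⟨ +-monoʳ-≤ (rim σ) (+-mono-≤ (+-mono-≤ (+-mono-≤ (corner≤1 σ false false) (corner≤1 σ false true)) (corner≤1 σ true false)) (corner≤1 σ true true)) ⟩
      rim σ + 4 ∎
      where
      open ≤-Reasoning
      E : Bool → Fin d → Fin k → ℕ
      E b i c = ind (OnFace? σ c ×-dec Pinned? b i c)
      K : Bool → Bool → Fin k → ℕ
      K b₁ b₂ c = ind (OnFace? σ c ×-dec (Pinned? b₁ i₁ c ×-dec Pinned? b₂ i₂ c))

    onEdge₁⇒onFace : ∀ σ b c → OnEdge (set σ i₂ b) i₁ c → OnFace σ c × Pinned b i₂ c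
    onEdge₁⇒onFace σ b c e =
      (λ j j≢i₁ j≢i₂ → subst (λ b → Pinned b j c) (set-≢ σ i₂ b j≢i₂) (e j j≢i₁)) ,
      subst (λ b → Pinned b i₂ c) (set-≡ σ i₂ b) (e i₂ (i₁≢i₂ ∘ sym))

    onEdge₂⇒onFace : ∀ σ b c → OnEdge (set σ i₁ b) i₂ c → OnFace σ c × Pinned b i₁ c
    onEdge₂⇒onFace σ b c e =
      (λ j j≢i₁ j≢i₂ → subst (λ b → Pinned b j c) (set-≢ σ i₁ b j≢i₁) (e j j≢i₂)) ,
      subst (λ b → Pinned b i₁ c) (set-≡ σ i₁ b) (e i₁ i₁≢i₂)

    -- The four edges give four tallies, with `h` one more than the gap allowed. Their constants add
    -- up to `4 * h`, which cancels against the corner bricks that are counted twice.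
    rim-bound : ∀ σ h → (∀ b → α i₁ + h ≤ s i₁ + h * edge σ b i₂) → (∀ b → α i₂ + h ≤ s i₂ + h * edge σ b i₁) →
      2 * (α i₁ + α i₂) ≤ 2 * (s i₁ + s i₂) + h * rim σ
    rim-bound σ h e₁ e₂ = +-cancelʳ-≤ (4 * h) _ _ (begin
      2 * (α i₁ + α i₂) + 4 * h
        ≡⟨ solve 3 (λ a b h → con 2 :* (a :+ b) :+ con 4 :* h := (a :+ h :+ (a :+ h)) :+ (b :+ h :+ (b :+ h))) refl (α i₁) (α i₂) h ⟩
      (α i₁ + h + (α i₁ + h)) + (α i₂ + h + (α i₂ + h))
        ≤⟨ +-mono-≤ (+-mono-≤ (e₁ false) (e₁ true)) (+-mono-≤ (e₂ false) (e₂ true)) ⟩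
      (s i₁ + h * p + (s i₁ + h * q)) + (s i₂ + h * r + (s i₂ + h * t))
        ≡⟨ solve 7 (λ a b h p q r t → (a :+ h :* p :+ (a :+ h :* q)) :+ (b :+ h :* r :+ (b :+ h :* t)) := con 2 :* (a :+ b) :+ h :* (r :+ t :+ p :+ q)) refl (s i₁) (s i₂) h p q r t ⟩
      2 * (s i₁ + s i₂) + h * (r + t + p + q)
        ≤⟨ +-monoʳ-≤ (2 * (s i₁ + s i₂)) (*-monoʳ-≤ h (edges≤rim+4 σ)) ⟩
      2 * (s i₁ + s i₂) + h * (rim σ + 4)
        ≡⟨ solve 3 (λ x h r → x :+ h :* (r :+ con 4) := x :+ h :* r :+ con 4 :* h) refl (2 * (s i₁ + s i₂)) h (rim σ) ⟩
      2 * (s i₁ + s i₂) + h * rim σ + 4 * h ∎)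
      where
      open ≤-Reasoning
      p = edge σ false i₂
      q = edge σ true i₂
      r = edge σ false i₁
      t = edge σ true i₁

    rim-bound₃ : ∀ σ → 2 * (α i₁ + α i₂) ≤ 2 * (s i₁ + s i₂) + 3 * rim σ
    rim-bound₃ σ = rim-bound σ 3
      (λ b → edge-tally (set σ i₂ b) i₁ (λ c → OnFace? σ c ×-dec Pinned? b i₂ c) (onEdge₁⇒onFace σ b))
      (λ b → edge-tally (set σ i₁ b) i₂ (λ c → OnFace? σ c ×-dec Pinned? b i₁ c) (onEdge₂⇒onFace σ b))

    rim-bound₂ : (∀ j → j ≢ i₁ → j ≢ i₂ → α j ≡ 0) → ∀ σ → 2 * (α i₁ + α i₂) ≤ 2 * (s i₁ + s i₂) + 2 * rim σ
    rim-bound₂ flat σ = rim-bound σ 2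
      (λ b → flat-edge-tally (set σ i₂ b) i₁ i₂ i₁≢i₂ flat (λ c → OnFace? σ c ×-dec Pinned? b i₂ c) (onEdge₁⇒onFace σ b))
      (λ b → flat-edge-tally (set σ i₁ b) i₂ i₁ (i₁≢i₂ ∘ sym) (λ j p q → flat j q p) (λ c → OnFace? σ c ×-dec Pinned? b i₁ c) (onEdge₂⇒onFace σ b))

    sum-1+γ : ∀ m → ∑ (λ c → 1 + γ c m) ≡ k + s m
    sum-1+γ m = trans (∑-distrib-+ {k} (λ _ → 1) (λ c → γ c m)) (cong (_+ s m) (trans (sum-const k 1) (*-identityʳ k)))

    onRim⇒pinned : ∀ σ b m → m ≢ i₁ → m ≢ i₂ → σ m ≡ b → ∀ {c} → OnRim σ c → Pinned b m c
    onRim⇒pinned σ b m m≢i₁ m≢i₂ refl (f , _) = f m m≢i₁ m≢i₂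

    -- The two faces lie at opposite ends of axis `m`. Each brick offers its length `1 + γ c m`
    -- along `m`; each rim membership takes one unit of it, and what remains pays for `α m` up to an
    -- error of 1.
    two-rims : ∀ m → m ≢ i₁ → m ≢ i₂ → 1 ≤ α m → ∀ σ₀ σ₁ → σ₀ m ≡ false → σ₁ m ≡ true →
      rim σ₀ + rim σ₁ + α m ≤ k + s m + 1
    two-rims m m≢i₁ m≢i₂ 1≤α σ₀ σ₁ σ₀≡ σ₁≡ = bound (any? λ c → L c m ≟ l m ×-dec U c m ≟ u m)
      where
      open ≤-Reasoning
      r₀ r₁ : Fin k → ℕ
      r₀ c = ind (OnRim? σ₀ c)
      r₁ c = ind (OnRim? σ₁ c)
      low : ∀ {c} → OnRim σ₀ c → L c m ≡ l m
      low = onRim⇒pinned σ₀ false m m≢i₁ m≢i₂ σ₀≡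
      high : ∀ {c} → OnRim σ₁ c → U c m ≡ u m
      high = onRim⇒pinned σ₁ true m m≢i₁ m≢i₂ σ₁≡
      bound : Dec (∃ (Spans m)) → rim σ₀ + rim σ₁ + α m ≤ k + s m + 1
      -- `c₀` accounts for `α m` alone, and its possible membership in both rims costs one unit more
      -- than it has left, whence the `+ 1`. Any other brick on both rims also spans `m`, so its
      -- `γ c m` is at least 1.
      bound (yes (c₀ , sp)) = begin
        rim σ₀ + rim σ₁ + α m
          ≡⟨ cong (rim σ₀ + rim σ₁ +_) (sym (sum-ind-≟-* c₀ (α m))) ⟩
        rim σ₀ + rim σ₁ + ∑ (λ c → α m * ind (c Fin.≟ c₀))
          ≡⟨ sum-+₃ {k} r₀ r₁ (λ c → α m * ind (c Fin.≟ c₀)) ⟨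
        ∑ (λ c → r₀ c + r₁ c + α m * ind (c Fin.≟ c₀))
          ≤⟨ sum-mono {k} (λ c → pointwise c (OnRim? σ₀ c) (OnRim? σ₁ c) (c Fin.≟ c₀)) ⟩
        ∑ (λ c → 1 + γ c m + ind (c Fin.≟ c₀))
          ≡⟨ ∑-distrib-+ {k} (λ c → 1 + γ c m) (λ c → ind (c Fin.≟ c₀)) ⟩
        ∑ (λ c → 1 + γ c m) + ∑ (λ c → ind (c Fin.≟ c₀))
          ≡⟨ cong₂ _+_ (sum-1+γ m) (sum-ind-≟ c₀) ⟩
        k + s m + 1 ∎
        where
        pointwise : ∀ c (A? : Dec (OnRim σ₀ c)) (B? : Dec (OnRim σ₁ c)) (C? : Dec (c ≡ c₀)) →
          ind A? + ind B? + α m * ind C? ≤ 1 + γ c m + ind C?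
        pointwise c A? B? (yes refl) = begin
          ind A? + ind B? + α m * 1 ≤⟨ +-mono-≤ (+-mono-≤ (ind≤1 A?) (ind≤1 B?)) (≤-reflexive (*-identityʳ (α m))) ⟩
          2 + α m                   ≡⟨ cong (2 +_) (spans⇒γ≡α sp) ⟨
          2 + γ c m                 ≡⟨ +-comm 1 (1 + γ c m) ⟩
          1 + γ c m + 1             ∎
        pointwise c A? B? (no _) = ≤-trans (≤-reflexive (trans (cong (ind A? + ind B? +_) (*-zeroʳ (α m))) (+-identityʳ _)))
          (≤-trans (two A? B?) (≤-reflexive (sym (+-identityʳ _))))
          where
          two : (A? : Dec (OnRim σ₀ c)) (B? : Dec (OnRim σ₁ c)) → ind A? + ind B? ≤ 1 + γ c m
          two (yes p) (yes q) = s≤s (≤-trans 1≤α (≤-reflexive (sym (spans⇒γ≡α {m} {c} (low p , high q)))))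
          two (yes _) (no _)  = s≤s z≤n
          two (no _)  B?      = ≤-trans (ind≤1 B?) (s≤s z≤n)
      -- No brick is on both rims, so discarding the first and the last cell of
      -- the axis shortens every brick of a rim by one cell.
      bound (no unspanned) = begin
        rim σ₀ + rim σ₁ + α m
          ≡⟨ cong (rim σ₀ + rim σ₁ +_) (sym (m∸n+n≡m 1≤α)) ⟩
        rim σ₀ + rim σ₁ + (α m ∸ 1 + 1)
          ≡⟨ +-assoc (rim σ₀ + rim σ₁) (α m ∸ 1) 1 ⟨
        rim σ₀ + rim σ₁ + (α m ∸ 1) + 1
          ≤⟨ +-monoˡ-≤ 1 (+-monoʳ-≤ (rim σ₀ + rim σ₁) (cover (suc (l m)) (α m ∸ 1) (λ c → r₀ c + L c m) (λ c → U c m ∸ r₁ c) covered)) ⟩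
        rim σ₀ + rim σ₁ + ∑ (λ c → U c m ∸ r₁ c ∸ (r₀ c + L c m)) + 1
          ≡⟨ cong (_+ 1) (sum-+₃ {k} r₀ r₁ (λ c → U c m ∸ r₁ c ∸ (r₀ c + L c m))) ⟨
        ∑ (λ c → r₀ c + r₁ c + (U c m ∸ r₁ c ∸ (r₀ c + L c m))) + 1
          ≤⟨ +-monoˡ-≤ 1 (sum-mono {k} (λ c → pointwise c (OnRim? σ₀ c) (OnRim? σ₁ c))) ⟩
        ∑ (λ c → 1 + γ c m) + 1
          ≡⟨ cong (_+ 1) (sum-1+γ m) ⟩
        k + s m + 1 ∎
        where
        pointwise : ∀ c (A? : Dec (OnRim σ₀ c)) (B? : Dec (OnRim σ₁ c)) →
          ind A? + ind B? + (U c m ∸ ind B? ∸ (ind A? + L c m)) ≤ 1 + γ c m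
        pointwise c (yes p) (yes q) = contradiction (c , low p , high q) unspanned
        pointwise c (yes _) (no _)  = ≤-refl
        pointwise c (no _)  (yes _) = ≤-reflexive (cong suc (∸-+-assoc (U c m) 1 (L c m)))
        pointwise c (no _)  (no _)  = ≤-reflexive (trans (cong (_∸ L c m) (trans (U≡ c m) (sym (+-suc (L c m) (γ c m))))) (m+n∸m≡n (L c m) (suc (γ c m))))
        covered : ∀ x → suc (l m) ≤ x → x < suc (l m) + (α m ∸ 1) → ∃ λ c → In (r₀ c + L c m) (U c m ∸ r₁ c) x
        covered x l<x x< with no-gap m x (<⇒≤ l<x) (<-trans x<l+α (≤-reflexive (sym (u≡ m))))
          where
          x<l+α : x < l m + α m
          x<l+α = ≤-trans x< (≤-reflexive (trans (sym (+-suc (l m) (α m ∸ 1))) (cong (l m +_) (trans (+-comm 1 _) (m∸n+n≡m 1≤α)))))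
        ... | c , L≤x , x<U = c , begins (OnRim? σ₀ c) , ends (OnRim? σ₁ c)
          where
          begins : (A? : Dec (OnRim σ₀ c)) → ind A? + L c m ≤ x
          begins (yes p) = ≤-trans (≤-reflexive (cong suc (low p))) l<x
          begins (no _)  = L≤x
          ends : (B? : Dec (OnRim σ₁ c)) → x < U c m ∸ ind B?
          ends (yes q) = ≤-trans x< (≤-reflexive (trans (trans (sym (+-suc (l m) (α m ∸ 1))) (cong (l m +_) (trans (+-comm 1 _) (m∸n+n≡m 1≤α))))
            (sym (cong (_∸ 1) (trans (high q) (u≡ m))))))
          ends (no _)  = x<U

    lower : Fin d → Bool
    lower _ = false

    raised : Fin d → Fin d → Bool
    raised m = set lower m true

    module _ {B : Fin d → Set} (B? : ∀ m → Dec (B m)) (B⇒ : ∀ {m} → B m → m ≢ i₁ × m ≢ i₂ × Unspanned m) where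

      raisedRim : Fin d → ℕ
      raisedRim m = ∑ (λ c → ind (B? m ×-dec OnRim? (raised m) c))

      raisedRim≡ : ∀ {m} → B m → raisedRim m ≡ rim (raised m)
      raisedRim≡ {m} b with B? m
      ... | yes _ = refl
      ... | no ¬b = contradiction b ¬b

      -- A brick on two of these rims would touch both ends of an axis in `B`, and those axes are
      -- unspanned. In `Q` the index `zero` stands for the rim of `lower` and `suc m` for the rim
      -- raised along `m`, so disjointness becomes uniqueness of the index.
      many-rims : rim lower + ∑ raisedRim ≤ k
      many-rims = begin
        rim lower + ∑ raisedRim
          ≡⟨ cong (rim lower +_) (∑-comm {d} {k} (λ m c → ind (B? m ×-dec OnRim? (raised m) c))) ⟩
        rim lower + ∑ (λ c → ∑ (λ m → ind (B? m ×-dec OnRim? (raised m) c)))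
          ≡⟨ ∑-distrib-+ {k} (λ c → ind (OnRim? lower c)) (λ c → ∑ (λ m → ind (B? m ×-dec OnRim? (raised m) c))) ⟨
        ∑ (λ c → ind (OnRim? lower c) + ∑ (λ m → ind (B? m ×-dec OnRim? (raised m) c)))
          ≤⟨ sum-mono {k} (λ c → sum-ind≤1 (Q? c) (λ {x} {y} → unique c x y)) ⟩
        ∑ {k} (λ _ → 1)
          ≡⟨ trans (sum-const k 1) (*-identityʳ k) ⟩
        k ∎
        where
        open ≤-Reasoning
        Q : Fin k → Fin (suc d) → Set
        Q c zero    = OnRim lower c
        Q c (suc m) = B m × OnRim (raised m) c
        Q? : ∀ c x → Dec (Q c x)
        Q? c zero    = OnRim? lower c
        Q? c (suc m) = B? m ×-dec OnRim? (raised m) c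
        clash : ∀ {m c} → B m → ∀ σ σ′ → σ m ≡ false → σ′ m ≡ true → OnRim σ c → ¬ OnRim σ′ c
        clash {m} {c} b σ σ′ σ≡ σ′≡ r r′ with B⇒ b
        ... | m≢i₁ , m≢i₂ , un = un c (onRim⇒pinned σ false m m≢i₁ m≢i₂ σ≡ r , onRim⇒pinned σ′ true m m≢i₁ m≢i₂ σ′≡ r′)
        unique : ∀ c x y → Q c x → Q c y → x ≡ y
        unique c zero    zero    _ _ = refl
        unique c zero    (suc m) r (b , r′) = contradiction r′ (clash b lower (raised m) refl (set-≡ lower m true) r)
        unique c (suc m) zero    (b , r′) r = contradiction r′ (clash b lower (raised m) refl (set-≡ lower m true) r)
        unique c (suc m) (suc n) (b , r) (b′ , r′) with n Fin.≟ m
        ... | yes refl = refl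
        ... | no n≢m = contradiction r′ (clash b′ (raised m) (raised n) (set-≢ lower m true n≢m) (set-≡ lower n true) r)

-- The packing inequality

∖-pos : ∀ {n} (f : Fin n → ℕ) i {j} → 0 < (f ∖ i) j → j ≢ i × (f ∖ i) j ≡ f j
∖-pos f i {j} = set-elim (λ x → 0 < x → j ≢ i × x ≡ f j) f i 0 j (λ _ ()) (λ j≢i _ → j≢i , refl)

sum-zero : ∀ {n} (f : Fin n → ℕ) → (∀ i → f i ≤ 0) → ∑ f ≤ 0
sum-zero {n} f f≤0 = ≤-trans (sum-mono f≤0) (≤-reflexive (trans (sum-const n 0) (*-zeroʳ n)))

-- Two rims of at least 2/3 of `t` make 4/3 of `t`, which exceeds `t` as `t` is positive. The
-- strictness later absorbs the `+ 1` of `two-rims`.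
half-rims : ∀ t a b → 0 < t → 2 * t ≤ 3 * a → 2 * t ≤ 3 * b → t < a + b
half-rims t a b 0<t p q = ≰⇒> λ a+b≤t → <⇒≱ 0<t (+-cancelʳ-≤ (3 * t) t 0 (begin
  t + 3 * t     ≡⟨ solve 1 (λ t → t :+ con 3 :* t := con 2 :* t :+ con 2 :* t) refl t ⟩
  2 * t + 2 * t ≤⟨ +-mono-≤ p q ⟩
  3 * a + 3 * b ≡⟨ *-distribˡ-+ 3 a b ⟨
  3 * (a + b)   ≤⟨ *-monoʳ-≤ 3 a+b≤t ⟩
  3 * t         ∎))
  where open ≤-Reasoning

module Bound {d k : ℕ} {l u : Fin d → ℕ} {L U : Fin k → Fin d → ℕ} (P : Packing l u L U) where
  open Packing P
  open PackingProperties P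

  module _ (spread : ∀ i c → ¬ AlmostFull i c) (i₀ : Fin d) (thick : suc (l i₀) < u i₀) where
    open Counting P spread i₀ thick
    open ≤-Reasoning

    δ : Fin d → ℕ
    δ i = α i ∸ s i

    α≤s+δ : ∀ i → α i ≤ s i + δ i
    α≤s+δ i = m≤n+m∸n (α i) (s i)

    0<δ⇒s<α : ∀ {i} → 0 < δ i → s i < α i
    0<δ⇒s<α {i} 0<δ = ≰⇒> λ α≤s → <⇒≱ 0<δ (≤-reflexive (m≤n⇒m∸n≡0 α≤s))

    δ≤0⇒α≤s : ∀ {i} → δ i ≤ 0 → α i ≤ s i
    δ≤0⇒α≤s {i} δ≤0 = ≤-trans (α≤s+δ i) (≤-trans (+-monoʳ-≤ (s i) δ≤0) (≤-reflexive (+-identityʳ _)))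

    sum-δ≤k⇒ : ∑ δ ≤ k → ∑ α ≤ k + ∑ s
    sum-δ≤k⇒ le = begin
      ∑ α                   ≤⟨ sum-mono {d} α≤s+δ ⟩
      ∑ (λ i → s i + δ i)   ≡⟨ ∑-distrib-+ {d} s δ ⟩
      ∑ s + ∑ δ           ≤⟨ +-monoʳ-≤ (∑ s) le ⟩
      ∑ s + k               ≡⟨ +-comm (∑ s) k ⟩
      k + ∑ s               ∎

    module _ (i₁ i₂ : Fin d) (i₂≢i₁ : i₂ ≢ i₁) (pos₁ : 0 < δ i₁) (pos₂ : 0 < δ i₂) where
      open TwoFace i₁ i₂ (i₂≢i₁ ∘ sym) (s<α⇒unspanned i₁ (0<δ⇒s<α pos₁)) (s<α⇒unspanned i₂ (0<δ⇒s<α pos₂))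

      t : ℕ
      t = δ i₁ + δ i₂

      α₁+α₂≡ : α i₁ + α i₂ ≡ s i₁ + s i₂ + t
      α₁+α₂≡ = trans (cong₂ _+_ (sym (m+[n∸m]≡n (<⇒≤ (0<δ⇒s<α pos₁)))) (sym (m+[n∸m]≡n (<⇒≤ (0<δ⇒s<α pos₂)))))
        (solve 4 (λ a b c e → a :+ b :+ (c :+ e) := a :+ c :+ (b :+ e)) refl (s i₁) (δ i₁) (s i₂) (δ i₂))

      2t≤3rim : ∀ σ → 2 * t ≤ 3 * rim σ
      2t≤3rim σ = +-cancelˡ-≤ (2 * (s i₁ + s i₂)) _ _ (begin
        2 * (s i₁ + s i₂) + 2 * t         ≡⟨ *-distribˡ-+ 2 (s i₁ + s i₂) t ⟨
        2 * (s i₁ + s i₂ + t)             ≡⟨ cong (2 *_) α₁+α₂≡ ⟨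
        2 * (α i₁ + α i₂)                 ≤⟨ rim-bound₃ σ ⟩
        2 * (s i₁ + s i₂) + 3 * rim σ     ∎)

      -- The rims at the two ends of `m` have more than `t` bricks together, and `two-rims` makes
      -- the bricks pay for `α m` as well. Axis `m` may be deficient or not, which covers three
      -- deficient axes as well as two with a further axis of length at least 2.
      three-axes : ∀ m → m ≢ i₁ → m ≢ i₂ → 1 ≤ α m → (∀ j → j ≢ i₁ → j ≢ i₂ → j ≢ m → α j ≤ s j) →
        ∑ α ≤ k + ∑ s
      three-axes m m≢i₁ m≢i₂ 1≤α rest = begin
        ∑ α
          ≡⟨ sum-split₃ α i₂≢i₁ m≢i₁ m≢i₂ ⟩
        α i₁ + α i₂ + α m + ∑ (α ∖ i₁ ∖ i₂ ∖ m)
          ≤⟨ +-mono-≤ special (sum-mono {d} (∖-mono m λ j j≢m → ∖-mono′ j j≢m)) ⟩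
        k + (s i₁ + s i₂ + s m) + ∑ (s ∖ i₁ ∖ i₂ ∖ m)
          ≡⟨ +-assoc k _ _ ⟩
        k + (s i₁ + s i₂ + s m + ∑ (s ∖ i₁ ∖ i₂ ∖ m))
          ≡⟨ cong (k +_) (sum-split₃ s i₂≢i₁ m≢i₁ m≢i₂) ⟨
        k + ∑ s ∎
        where
        ∖-mono′ : ∀ j → j ≢ m → (α ∖ i₁ ∖ i₂) j ≤ (s ∖ i₁ ∖ i₂) j
        ∖-mono′ j j≢m = set-elim₂ _≤_ (α ∖ i₁) (s ∖ i₁) i₂ 0 0 j (λ _ → z≤n) λ j≢i₂ →
          set-elim₂ _≤_ α s i₁ 0 0 j (λ _ → z≤n) λ j≢i₁ → rest j j≢i₁ j≢i₂ j≢m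
        special : α i₁ + α i₂ + α m ≤ k + (s i₁ + s i₂ + s m)
        special = +-cancelʳ-≤ 1 _ _ (begin
          α i₁ + α i₂ + α m + 1
            ≡⟨ cong (λ x → x + α m + 1) α₁+α₂≡ ⟩
          s i₁ + s i₂ + t + α m + 1
            ≡⟨ solve 3 (λ x t a → x :+ t :+ a :+ con 1 := x :+ (con 1 :+ t :+ a)) refl (s i₁ + s i₂) t (α m) ⟩
          s i₁ + s i₂ + (suc t + α m)
            ≤⟨ +-monoʳ-≤ (s i₁ + s i₂) (+-monoˡ-≤ (α m) (half-rims t (rim lower) (rim (raised m)) (≤-trans pos₁ (m≤m+n _ _)) (2t≤3rim lower) (2t≤3rim (raised m)))) ⟩
          s i₁ + s i₂ + (rim lower + rim (raised m) + α m)
            ≤⟨ +-monoʳ-≤ (s i₁ + s i₂) (two-rims m m≢i₁ m≢i₂ 1≤α lower (raised m) refl (set-≡ lower m true)) ⟩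
          s i₁ + s i₂ + (k + s m + 1)
            ≡⟨ solve 3 (λ x k y → x :+ (k :+ y :+ con 1) := k :+ (x :+ y) :+ con 1) refl (s i₁ + s i₂) k (s m) ⟩
          k + (s i₁ + s i₂ + s m) + 1 ∎)

      -- With gaps of length at most 1 a single rim has at least `t` bricks, and it has at most `k`.
      two-axes : (∀ j → j ≢ i₁ → j ≢ i₂ → α j ≡ 0) → ∑ α ≤ k + ∑ s
      two-axes flat = begin
        ∑ α
          ≡⟨ sum-split₂ α i₂≢i₁ ⟩
        α i₁ + α i₂ + ∑ (α ∖ i₁ ∖ i₂)
          ≤⟨ +-mono-≤ special (sum-mono {d} (∖-mono i₂ λ j j≢i₂ → set-elim₂ _≤_ α s i₁ 0 0 j (λ _ → z≤n) λ j≢i₁ →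
               ≤-trans (≤-reflexive (flat j j≢i₁ j≢i₂)) z≤n)) ⟩
        k + (s i₁ + s i₂) + ∑ (s ∖ i₁ ∖ i₂)
          ≡⟨ +-assoc k _ _ ⟩
        k + (s i₁ + s i₂ + ∑ (s ∖ i₁ ∖ i₂))
          ≡⟨ cong (k +_) (sum-split₂ s i₂≢i₁) ⟨
        k + ∑ s ∎
        where
        rim≤k : rim lower ≤ k
        rim≤k = ≤-trans (sum-mono {k} (λ c → ind≤1 (OnRim? lower c))) (≤-reflexive (trans (sum-const k 1) (*-identityʳ k)))
        special : α i₁ + α i₂ ≤ k + (s i₁ + s i₂)
        special = *-cancelˡ-≤ 2 (begin
          2 * (α i₁ + α i₂)                 ≤⟨ rim-bound₂ flat lower ⟩
          2 * (s i₁ + s i₂) + 2 * rim lower ≡⟨ *-distribˡ-+ 2 (s i₁ + s i₂) (rim lower) ⟨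
          2 * (s i₁ + s i₂ + rim lower)     ≤⟨ *-monoʳ-≤ 2 (+-monoʳ-≤ (s i₁ + s i₂) rim≤k) ⟩
          2 * (s i₁ + s i₂ + k)             ≡⟨ cong (2 *_) (+-comm (s i₁ + s i₂) k) ⟩
          2 * (k + (s i₁ + s i₂))           ∎)

      δ″ : Fin d → ℕ
      δ″ = δ ∖ i₁ ∖ i₂

      0<δ″⇒ : ∀ {j} → 0 < δ″ j → j ≢ i₁ × j ≢ i₂ × δ″ j ≡ δ j
      0<δ″⇒ {j} pos with ∖-pos (δ ∖ i₁) i₂ pos
      ... | j≢i₂ , eq with ∖-pos δ i₁ (subst (0 <_) eq pos)
      ... | j≢i₁ , eq′ = j≢i₁ , j≢i₂ , trans eq eq′

      -- Each further deficit is at most t / 2, each further rim has at least 2t / 3 bricks.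
      many-axes : (∀ j → δ j ≤ δ i₁) → (∀ j → j ≢ i₁ → δ j ≤ δ i₂) →
        ∀ m n → n ≢ m → 0 < δ″ m → 0 < δ″ n → ∑ α ≤ k + ∑ s
      many-axes max₁ max₂ m n n≢m posm posn = sum-δ≤k⇒ (*-cancelˡ-≤ 6 (begin
        6 * ∑ δ
          ≡⟨ cong (6 *_) (sum-split₂ δ i₂≢i₁) ⟩
        6 * (t + ∑ δ″)
          -- Of the `6 * t` owed, the rim of `lower` pays `4 * t`. The missing `2 * t` are the
          -- surplus of at least two further axes, each leaving 6 times (2/3 - 1/2) of `t`, that is,
          -- `t`.
          ≡⟨ solve 2 (λ t x → con 6 :* (t :+ x) := con 2 :* (con 2 :* t) :+ (con 6 :* x :+ t :* con 2)) refl t (∑ δ″) ⟩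
        2 * (2 * t) + (6 * ∑ δ″ + t * 2)
          ≤⟨ +-mono-≤ (*-monoʳ-≤ 2 (2t≤3rim lower)) axes ⟩
        2 * (3 * rim lower) + 6 * ∑ raised″
          ≡⟨ solve 2 (λ x y → con 2 :* (con 3 :* x) :+ con 6 :* y := con 6 :* (x :+ y)) refl (rim lower) (∑ raised″) ⟩
        6 * (rim lower + ∑ raised″)
          ≤⟨ *-monoʳ-≤ 6 (many-rims pos? λ pos → bad pos) ⟩
        6 * k ∎))
        where
        pos? : ∀ j → Dec (0 < δ″ j)
        pos? j = 0 <? δ″ j
        bad : ∀ {j} → 0 < δ″ j → j ≢ i₁ × j ≢ i₂ × Unspanned j
        bad {j} pos with 0<δ″⇒ pos
        ... | j≢i₁ , j≢i₂ , eq = j≢i₁ , j≢i₂ , s<α⇒unspanned j (0<δ⇒s<α (subst (0 <_) eq pos))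
        raised″ : Fin d → ℕ
        raised″ = raisedRim pos? λ pos → bad pos
        2≤count : 2 ≤ ∑ (λ j → ind (pos? j))
        2≤count = ≤-trans (≤-reflexive (sym (cong₂ _+_ (ind-yes (pos? m) posm) (ind-yes (pos? n) posn))))
          (two-terms≤∑ (λ j → ind (pos? j)) n≢m)
        pointwise : ∀ j → 6 * δ″ j + t * ind (pos? j) ≤ 6 * raised″ j
        pointwise j = go (pos? j)
          where
          go : Dec (0 < δ″ j) → 6 * δ″ j + t * ind (pos? j) ≤ 6 * raised″ j
          go (no ¬pos) = ≤-trans (≤-reflexive (trans
            (cong₂ (λ x y → 6 * x + t * y) (n≤0⇒n≡0 (≮⇒≥ ¬pos)) (ind-no (pos? j) ¬pos)) (*-zeroʳ t))) z≤n
          go (yes pos) with 0<δ″⇒ pos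
          ... | j≢i₁ , j≢i₂ , δ″≡δ = begin
            6 * δ″ j + t * ind (pos? j)
              ≡⟨ cong₂ (λ x y → 6 * x + t * y) δ″≡δ (ind-yes (pos? j) pos) ⟩
            6 * δ j + t * 1
              ≡⟨ solve 2 (λ x t → con 6 :* x :+ t :* con 1 := con 3 :* (x :+ x) :+ t) refl (δ j) t ⟩
            3 * (δ j + δ j) + t
              ≤⟨ +-monoˡ-≤ t (*-monoʳ-≤ 3 (+-mono-≤ (max₁ j) (max₂ j j≢i₁))) ⟩
            3 * t + t
              ≡⟨ solve 1 (λ t → con 3 :* t :+ t := con 2 :* (con 2 :* t)) refl t ⟩
            2 * (2 * t)
              ≤⟨ *-monoʳ-≤ 2 (2t≤3rim (raised j)) ⟩
            2 * (3 * rim (raised j))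
              ≡⟨ *-assoc 2 3 (rim (raised j)) ⟨
            6 * rim (raised j)
              ≡⟨ cong (6 *_) (raisedRim≡ pos? (λ pos → bad pos) pos) ⟨
            6 * raised″ j ∎
        axes : 6 * ∑ δ″ + t * 2 ≤ 6 * ∑ raised″
        axes = begin
          6 * ∑ δ″ + t * 2
            ≤⟨ +-monoʳ-≤ (6 * ∑ δ″) (*-monoʳ-≤ t 2≤count) ⟩
          6 * ∑ δ″ + t * ∑ (λ j → ind (pos? j))
            ≡⟨ cong₂ _+_ (*-distribˡ-sum {d} 6 δ″) (*-distribˡ-sum {d} t (λ j → ind (pos? j))) ⟩
          ∑ (λ j → 6 * δ″ j) + ∑ (λ j → t * ind (pos? j))
            ≡⟨ ∑-distrib-+ {d} (λ j → 6 * δ″ j) (λ j → t * ind (pos? j)) ⟨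
          ∑ (λ j → 6 * δ″ j + t * ind (pos? j))
            ≤⟨ sum-mono {d} pointwise ⟩
          ∑ (λ j → 6 * raised″ j)
            ≡⟨ *-distribˡ-sum {d} 6 raised″ ⟨
          6 * ∑ raised″ ∎

    -- The deficit of a single axis is bounded by `k` through `slab-tally`.
    one-axis : ∀ i → (∀ j → j ≢ i → δ j ≤ 0) → ∑ α ≤ k + ∑ s
    one-axis i rest = sum-δ≤k⇒ (begin
      ∑ δ               ≡⟨ sum-split δ i ⟩
      δ i + ∑ (δ ∖ i)   ≤⟨ +-mono-≤ δ≤k (sum-zero (δ ∖ i) λ j → set-elim (_≤ 0) δ i 0 j (λ _ → z≤n) (rest j)) ⟩
      k + 0               ≡⟨ +-identityʳ k ⟩
      k                   ∎)
      where
      δ≤k : δ i ≤ k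
      δ≤k = m≤n+o⇒m∸n≤o (α i) (s i) (≤-trans (m≤m+n _ 1) (slab-tally i))

    -- Repeated `argmax` takes the axes in order of decreasing deficit. The cases are at most one
    -- deficient axis, at least four, exactly three, and exactly two; the last one depends on
    -- whether another axis has length at least 2.
    spread-bound : ∑ α ≤ k + ∑ s
    spread-bound with argmax δ i₀
    ... | i₁ , max₁ with argmax (δ ∖ i₁) i₀
    ... | i₂ , max₂ with 0 <? (δ ∖ i₁) i₂
    ... | no ¬pos = one-axis i₁ λ j j≢i₁ → ≤-trans (≤-reflexive (sym (set-≢ δ i₁ 0 j≢i₁))) (≤-trans (max₂ j) (≮⇒≥ ¬pos))
    ... | yes pos with ∖-pos δ i₁ pos
    ... | i₂≢i₁ , eq = rest
      where
      pos₂ : 0 < δ i₂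
      pos₂ = subst (0 <_) eq pos
      pos₁ : 0 < δ i₁
      pos₁ = <-≤-trans pos₂ (max₁ i₂)
      δ₂ : Fin d → ℕ
      δ₂ = δ ∖ i₁ ∖ i₂
      δ₂≡ : ∀ {j} → j ≢ i₁ → j ≢ i₂ → δ₂ j ≡ δ j
      δ₂≡ j≢i₁ j≢i₂ = trans (set-≢ (δ ∖ i₁) i₂ 0 j≢i₂) (set-≢ δ i₁ 0 j≢i₁)
      rest : ∑ α ≤ k + ∑ s
      rest with argmax δ₂ i₀
      ... | i₃ , max₃ with 0 <? δ₂ i₃
      rest | i₃ , max₃ | yes pos₃ with argmax (δ₂ ∖ i₃) i₀
      ... | i₄ , max₄ with 0 <? (δ₂ ∖ i₃) i₄
      ... | yes pos₄ = let i₄≢i₃ , eq₄ = ∖-pos δ₂ i₃ pos₄ in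
            many-axes i₁ i₂ i₂≢i₁ pos₁ pos₂ max₁
              (λ j j≢i₁ → ≤-trans (≤-reflexive (sym (set-≢ δ i₁ 0 j≢i₁))) (≤-trans (max₂ j) (≤-reflexive eq)))
              i₃ i₄ i₄≢i₃ pos₃ (subst (0 <_) eq₄ pos₄)
      ... | no ¬pos₄ = let i₃≢i₁ , i₃≢i₂ , eq₃ = 0<δ″⇒ i₁ i₂ i₂≢i₁ pos₁ pos₂ pos₃ in
            three-axes i₁ i₂ i₂≢i₁ pos₁ pos₂ i₃ i₃≢i₁ i₃≢i₂ (≤-trans (s≤s z≤n) (0<δ⇒s<α (subst (0 <_) eq₃ pos₃)))
              λ j j≢i₁ j≢i₂ j≢i₃ → δ≤0⇒α≤s (≤-trans (≤-reflexive (sym (trans (set-≢ δ₂ i₃ 0 j≢i₃) (δ₂≡ j≢i₁ j≢i₂)))) (≤-trans (max₄ j) (≮⇒≥ ¬pos₄)))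
      rest | i₃ , max₃ | no ¬pos₃ with any? (λ m → ¬? (m Fin.≟ i₁) ×-dec (¬? (m Fin.≟ i₂) ×-dec 1 ≤? α m))
      ... | yes (m , m≢i₁ , m≢i₂ , 1≤α) = three-axes i₁ i₂ i₂≢i₁ pos₁ pos₂ m m≢i₁ m≢i₂ 1≤α
              λ j j≢i₁ j≢i₂ _ → δ≤0⇒α≤s (≤-trans (≤-reflexive (sym (δ₂≡ j≢i₁ j≢i₂))) (≤-trans (max₃ j) (≮⇒≥ ¬pos₃)))
      ... | no none = two-axes i₁ i₂ i₂≢i₁ pos₁ pos₂ λ j j≢i₁ j≢i₂ → n≤0⇒n≡0 (≤-pred (≰⇒> λ 1≤α → none (j , j≢i₁ , j≢i₂ , 1≤α)))

  weight : Fin k → ℕ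
  weight c = suc (∑ (γ c))

  sum-weight : ∑ weight ≡ k + ∑ s
  sum-weight = trans (∑-distrib-+ {k} (λ _ → 1) (λ c → ∑ (γ c)))
    (cong₂ _+_ (trans (sum-const k 1) (*-identityʳ k)) (∑-comm {k} {d} γ))

  -- Packings with a brick spanning all axes but one

  module _ (i : Fin d) (c : Fin k) (almost : AlmostFull i c) where
    open ≤-Reasoning

    α≤γ : ∀ j → j ≢ i → α j ≤ γ c j
    α≤γ j j≢i = ≤-reflexive (sym (spans⇒γ≡α (almost j j≢i)))

    one-part : α i ≤ γ c i + 1 → ∑ α ≤ ∑ weight
    one-part le = begin
      ∑ α                                           ≤⟨ sum-mono {d} pointwise ⟩
      ∑ (λ j → γ c j + ind (j Fin.≟ i))             ≡⟨ ∑-distrib-+ {d} (γ c) (λ j → ind (j Fin.≟ i)) ⟩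
      ∑ (γ c) + ∑ (λ j → ind (j Fin.≟ i))         ≡⟨ cong (∑ (γ c) +_) (sum-ind-≟ i) ⟩
      ∑ (γ c) + 1                                   ≡⟨ +-comm _ 1 ⟩
      weight c                                        ≤⟨ term≤∑ weight c ⟩
      ∑ weight                                      ∎
      where
      pointwise : ∀ j → α j ≤ γ c j + ind (j Fin.≟ i)
      pointwise j with j Fin.≟ i
      ... | yes refl = le
      ... | no j≢i = ≤-trans (α≤γ j j≢i) (m≤m+n _ _)

    -- Two bricks with a unit gap between them fill an axis exactly when the inequality for `α i` is
    -- an equality; the 2 is paid by the constants of the two weights.
    two-parts : ∀ e → e ≢ c → α i ≤ γ c i + γ e i + 2 → ∑ α ≤ ∑ weight
    two-parts e e≢c le = begin
      ∑ α                                                   ≤⟨ sum-mono {d} pointwise ⟩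
      ∑ (λ j → γ c j + γ e j + 2 * ind (j Fin.≟ i))         ≡⟨ sum-+₃ {d} (γ c) (γ e) (λ j → 2 * ind (j Fin.≟ i)) ⟩
      ∑ (γ c) + ∑ (γ e) + ∑ (λ j → 2 * ind (j Fin.≟ i)) ≡⟨ cong (∑ (γ c) + ∑ (γ e) +_) (sum-ind-≟-* i 2) ⟩
      ∑ (γ c) + ∑ (γ e) + 2                               ≡⟨ solve 2 (λ x y → x :+ y :+ con 2 := con 1 :+ x :+ (con 1 :+ y)) refl (∑ (γ c)) (∑ (γ e)) ⟩
      weight c + weight e                                     ≤⟨ two-terms≤∑ weight e≢c ⟩
      ∑ weight                                              ∎
      where
      pointwise : ∀ j → α j ≤ γ c j + γ e j + 2 * ind (j Fin.≟ i)
      pointwise j with j Fin.≟ i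
      ... | yes refl = le
      ... | no j≢i = ≤-trans (α≤γ j j≢i) (≤-trans (m≤m+n _ (γ e j)) (m≤m+n _ _))

    others : ∀ e → e ≢ c → U e i < L c i ⊎ U c i < L e i
    others e e≢c with disjoint e≢c
    ... | j , sep with j Fin.≟ i
    ... | yes refl = sep
    ... | no j≢i = contradiction sep λ
      { (inj₁ lt) → <⇒≱ (<-trans (brick e j) lt) (≤-trans (≤-reflexive (proj₁ (almost j j≢i))) (l≤L e j))
      ; (inj₂ lt) → <⇒≱ (<-trans lt (brick e j)) (≤-trans (U≤u e j) (≤-reflexive (sym (proj₂ (almost j j≢i))))) }

    -- The box from `l i` up to `U c i` contains `c` and the bricks before it and avoids those after
    -- it, so it lies in a brick. That brick contains `c`, hence is `c`, which does not reach down
    -- to `l i`.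
    not-central : l i < L c i → U c i < u i → ⊥
    not-central l<L U<u with saturated l (set u i (U c i)) box compatible
      where
      box : ∀ j → l j ≤ l j × l j < set u i (U c i) j × set u i (U c i) j ≤ u j
      box j = ≤-refl , set-elim (λ b → l j < b × b ≤ u j) u i (U c i) j
        (λ { refl → <-trans l<L (brick c i) , U≤u c i }) (λ _ → ambient j , ≤-refl)
      compatible : ∀ e → (∀ j → l j ≤ L e j × U e j ≤ set u i (U c i) j) ⊎ (∃ λ j → U e j < l j ⊎ set u i (U c i) j < L e j)
      compatible e with e Fin.≟ c
      ... | yes refl = inj₁ λ j → l≤L e j , set-elim (U e j ≤_) u i (U c i) j (λ { refl → ≤-refl }) (λ _ → U≤u e j)
      ... | no e≢c with others e e≢c
      ... | inj₁ lt = inj₁ λ j → l≤L e j , set-elim (U e j ≤_) u i (U c i) j (λ { refl → <⇒≤ (<-trans lt (brick c i)) }) (λ _ → U≤u e j)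
      ... | inj₂ lt = inj₂ (i , inj₂ (subst (_< L e i) (sym (set-≡ u i (U c i))) lt))
    ... | inj₁ full = <⇒≱ U<u (subst (u i ≤_) (set-≡ u i (U c i)) (proj₂ (full i)))
    ... | inj₂ (e , sub) = c≢e (⊆⇒≡ c e λ j → ≤-trans (proj₁ (sub j)) (l≤L c j) ,
          ≤-trans (set-elim (U c j ≤_) u i (U c i) j (λ { refl → ≤-refl }) (λ _ → U≤u c j)) (proj₂ (sub j)))
      where
      c≢e : c ≢ e
      c≢e refl = <⇒≱ l<L (proj₁ (sub i))

    -- Unless a single layer is left beyond `c`, the box starting one unit after `c` contains all
    -- other bricks and so lies in one brick `e`. Then `c`, `e` and a unit gap account for axis `i`.
    left-part : L c i ≡ l i → U c i < u i → ∑ α ≤ ∑ weight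
    left-part L≡l U<u with m≤n⇒m<n∨m≡n U<u
    ... | inj₂ 1+U≡u = one-part (≤-reflexive (trans (+-cancelˡ-≡ (suc (l i)) _ _ (begin-equality
      suc (l i) + α i         ≡⟨ u≡ i ⟨
      u i                     ≡⟨ 1+U≡u ⟨
      suc (U c i)             ≡⟨ cong suc (U≡ c i) ⟩
      suc (suc (L c i + γ c i)) ≡⟨ cong (λ x → suc (suc (x + γ c i))) L≡l ⟩
      suc (suc (l i + γ c i)) ≡⟨ cong suc (sym (+-suc (l i) (γ c i))) ⟩
      suc (l i) + suc (γ c i) ∎)) (+-comm 1 _)))
    ... | inj₁ 1+U<u with saturated (set l i (suc (U c i))) u box compatible
      where
      box : ∀ j → l j ≤ set l i (suc (U c i)) j × set l i (suc (U c i)) j < u j × u j ≤ u j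
      box j = set-elim (λ a → l j ≤ a × a < u j × u j ≤ u j) l i (suc (U c i)) j
        (λ { refl → ≤-trans (l≤L c i) (≤-trans (<⇒≤ (brick c i)) (n≤1+n _)) , 1+U<u , ≤-refl })
        (λ _ → ≤-refl , ambient j , ≤-refl)
      compatible : ∀ e → (∀ j → set l i (suc (U c i)) j ≤ L e j × U e j ≤ u j) ⊎ (∃ λ j → U e j < set l i (suc (U c i)) j ⊎ u j < L e j)
      compatible e with e Fin.≟ c
      ... | yes refl = inj₂ (i , inj₁ (≤-reflexive (sym (set-≡ l i (suc (U c i))))))
      ... | no e≢c with others e e≢c
      ... | inj₁ lt = contradiction (≤-trans (≤-reflexive L≡l) (l≤L e i)) (<⇒≱ (<-trans (brick e i) lt))
      ... | inj₂ lt = inj₁ λ j → set-elim (_≤ L e j) l i (suc (U c i)) j (λ { refl → lt }) (λ _ → l≤L e j) , U≤u e j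
    ... | inj₁ full = contradiction (subst (_≤ l i) (set-≡ l i (suc (U c i))) (proj₁ (full i)))
          (<⇒≱ (s≤s (≤-trans (l≤L c i) (<⇒≤ (brick c i)))))
    ... | inj₂ (e , sub) = two-parts e (λ { refl → <⇒≱ U<u (proj₂ (sub i)) }) (+-cancelˡ-≤ (suc (l i)) _ _ (begin
      suc (l i) + α i                         ≡⟨ u≡ i ⟨
      u i                                     ≤⟨ proj₂ (sub i) ⟩
      U e i                                   ≡⟨ U≡ e i ⟩
      suc (L e i + γ e i)                     ≤⟨ s≤s (+-monoˡ-≤ (γ e i) (subst (L e i ≤_) (set-≡ l i (suc (U c i))) (proj₁ (sub i)))) ⟩
      suc (suc (U c i) + γ e i)               ≡⟨ cong (λ x → suc (suc x + γ e i)) (U≡ c i) ⟩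
      suc (suc (suc (L c i + γ c i)) + γ e i) ≡⟨ cong (λ x → suc (suc (suc (x + γ c i)) + γ e i)) L≡l ⟩
      suc (suc (suc (l i + γ c i)) + γ e i)   ≡⟨ solve 3 (λ a b c → con 3 :+ (a :+ b) :+ c := con 1 :+ a :+ (b :+ c :+ con 2)) refl (l i) (γ c i) (γ e i) ⟩
      suc (l i) + (γ c i + γ e i + 2)         ∎))

    right-part : l i < L c i → U c i ≡ u i → ∑ α ≤ ∑ weight
    right-part l<L U≡u with m≤n⇒m<n∨m≡n l<L
    ... | inj₂ 1+l≡L = one-part (≤-reflexive (trans (+-cancelˡ-≡ (suc (l i)) _ _ (begin-equality
      suc (l i) + α i           ≡⟨ u≡ i ⟨
      u i                       ≡⟨ U≡u ⟨
      U c i                     ≡⟨ U≡ c i ⟩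
      suc (L c i + γ c i)       ≡⟨ cong (λ x → suc (x + γ c i)) 1+l≡L ⟨
      suc (suc (l i + γ c i))   ≡⟨ cong suc (sym (+-suc (l i) (γ c i))) ⟩
      suc (l i) + suc (γ c i)   ∎)) (+-comm 1 _)))
    ... | inj₁ 1+l<L with saturated l (set u i (pred (L c i))) box compatible
      where
      1+pred : suc (pred (L c i)) ≡ L c i
      1+pred = suc-pred (L c i) ⦃ >-nonZero (≤-<-trans z≤n l<L) ⦄
      pred≤u : pred (L c i) ≤ u i
      pred≤u = ≤-trans (≤-trans (n≤1+n _) (≤-reflexive 1+pred)) (≤-trans (<⇒≤ (brick c i)) (U≤u c i))
      box : ∀ j → l j ≤ l j × l j < set u i (pred (L c i)) j × set u i (pred (L c i)) j ≤ u j
      box j = ≤-refl , set-elim (λ b → l j < b × b ≤ u j) u i (pred (L c i)) j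
        (λ { refl → ≤-pred (≤-trans 1+l<L (≤-reflexive (sym 1+pred))) , pred≤u }) (λ _ → ambient j , ≤-refl)
      compatible : ∀ e → (∀ j → l j ≤ L e j × U e j ≤ set u i (pred (L c i)) j) ⊎ (∃ λ j → U e j < l j ⊎ set u i (pred (L c i)) j < L e j)
      compatible e with e Fin.≟ c
      ... | yes refl = inj₂ (i , inj₂ (subst (_< L e i) (sym (set-≡ u i (pred (L c i)))) (≤-reflexive 1+pred)))
      ... | no e≢c with others e e≢c
      ... | inj₁ lt = inj₁ λ j → l≤L e j , set-elim (U e j ≤_) u i (pred (L c i)) j (λ { refl → ≤-pred (≤-trans lt (≤-reflexive (sym 1+pred))) }) (λ _ → U≤u e j)
      ... | inj₂ lt = contradiction (≤-trans (U≤u e i) (≤-reflexive (sym U≡u))) (<⇒≱ (<-trans lt (brick e i)))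
    ... | inj₁ full = contradiction (subst (u i ≤_) (set-≡ u i (pred (L c i))) (proj₂ (full i)))
          (<⇒≱ (≤-trans (≤-reflexive (suc-pred (L c i) ⦃ >-nonZero (≤-<-trans z≤n l<L) ⦄)) (≤-trans (<⇒≤ (brick c i)) (U≤u c i))))
    ... | inj₂ (e , sub) = two-parts e (λ { refl → <⇒≱ l<L (proj₁ (sub i)) }) (+-cancelˡ-≤ (suc (l i)) _ _ (begin
      suc (l i) + α i                         ≡⟨ u≡ i ⟨
      u i                                     ≡⟨ U≡u ⟨
      U c i                                   ≡⟨ U≡ c i ⟩
      suc (L c i + γ c i)                     ≡⟨ cong (λ x → suc (x + γ c i)) (suc-pred (L c i) ⦃ >-nonZero (≤-<-trans z≤n l<L) ⦄) ⟨
      suc (suc (pred (L c i)) + γ c i)        ≤⟨ s≤s (s≤s (+-monoˡ-≤ (γ c i) (subst (_≤ U e i) (set-≡ u i (pred (L c i))) (proj₂ (sub i))))) ⟩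
      suc (suc (U e i) + γ c i)               ≡⟨ cong (λ x → suc (suc x + γ c i)) (U≡ e i) ⟩
      suc (suc (suc (L e i + γ e i)) + γ c i) ≤⟨ s≤s (s≤s (s≤s (+-monoˡ-≤ (γ c i) (+-monoˡ-≤ (γ e i) (proj₁ (sub i)))))) ⟩
      suc (suc (suc (l i + γ e i)) + γ c i)   ≡⟨ solve 3 (λ a b c → con 3 :+ (a :+ b) :+ c := con 1 :+ a :+ (c :+ b :+ con 2)) refl (l i) (γ e i) (γ c i) ⟩
      suc (l i) + (γ c i + γ e i + 2)         ∎))

    almost-full-bound : ∑ α ≤ ∑ weight
    almost-full-bound with m≤n⇒m<n∨m≡n (l≤L c i) | m≤n⇒m<n∨m≡n (U≤u c i)
    ... | inj₁ l<L | inj₁ U<u = contradiction (not-central l<L U<u) λ ()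
    ... | inj₁ l<L | inj₂ U≡u = right-part l<L U≡u
    ... | inj₂ l≡L | inj₁ U<u = left-part (sym l≡L) U<u
    ... | inj₂ l≡L | inj₂ U≡u = contradiction full (proper c)
      where
      full : ∀ j → L c j ≤ l j × u j ≤ U c j
      full j with j Fin.≟ i
      ... | yes refl = ≤-reflexive (sym l≡L) , ≤-reflexive (sym U≡u)
      ... | no j≢i = ≤-reflexive (proj₁ (almost j j≢i)) , ≤-reflexive (sym (proj₂ (almost j j≢i)))

  -- The inequality w(B) ≤ 1 + Σ w(C), with 1 subtracted on both sides. If every axis has length 1,
  -- the left side is 0.
  packing-bound : ∑ α ≤ ∑ weight
  packing-bound with any? (λ i → any? λ c → AlmostFull? i c)
  ... | yes (i , c , almost) = almost-full-bound i c almost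
  ... | no spread with any? (λ i → suc (l i) <? u i)
  ... | yes (i₀ , thick) = ≤-trans (spread-bound (λ i c almost → spread (i , c , almost)) i₀ thick) (≤-reflexive (sym sum-weight))
  ... | no thin = ≤-trans (sum-zero α λ i → ≤-reflexive (m≤n⇒m∸n≡0 (≮⇒≥ λ lt → thin (i , lt)))) z≤n

-- The lower bound

lookup-injective : ∀ {A : Set} {xs : List A} → Unique xs → ∀ i j → List.lookup xs i ≡ List.lookup xs j → i ≡ j
lookup-injective (_ ∷ _)    zero    zero    _  = refl
lookup-injective (x∉ ∷ _)   zero    (suc j) eq = contradiction eq (All.lookup x∉ (∈-lookup j))
lookup-injective (x∉ ∷ _)   (suc i) zero    eq = contradiction (sym eq) (All.lookup x∉ (∈-lookup i))
lookup-injective (_ ∷ uniq) (suc i) (suc j) eq = cong suc (lookup-injective uniq i j eq)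

vec-ext : ∀ {d} {v w : Vec ℕ d} → (∀ i → lookup v i ≡ lookup w i) → v ≡ w
vec-ext {v = v} {w} eq = trans (sym (Vecₚ.tabulate∘lookup v)) (trans (Vecₚ.tabulate-cong eq) (Vecₚ.tabulate∘lookup w))

sum-mono-< : ∀ {n} {f g : Fin n → ℕ} → (∀ i → f i ≤ g i) → ∀ i → f i < g i → ∑ f < ∑ g
sum-mono-< f≤g zero    lt = +-mono-<-≤ lt (sum-mono (f≤g ∘ suc))
sum-mono-< f≤g (suc i) lt = +-mono-≤-< (f≤g zero) (sum-mono-< (f≤g ∘ suc) i lt)

infix 4 _⊆B?_ _≟B_ _∈B?_

_⊆B?_ : ∀ {d} (B C : Box d) → Dec (B ⊆B C)
B ⊆B? C = all? λ i → lookup (lo C) i ≤? lookup (lo B) i ×-dec lookup (hi B) i ≤? lookup (hi C) i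

_≟B_ : ∀ {d} (B C : Box d) → Dec (B ≡ C)
_≟B_ = Productₚ.≡-dec (Vecₚ.≡-dec _≟_) (Vecₚ.≡-dec _≟_)

_∈B?_ : ∀ {d} (B : Box d) (H : List (Box d)) → Dec (B ∈ H)
_∈B?_ = DecMembership._∈?_ _≟B_

⊆B-refl : ∀ {d} (B : Box d) → B ⊆B B
⊆B-refl B i = ≤-refl , ≤-refl

⊆B-trans : ∀ {d} (B C D : Box d) → B ⊆B C → C ⊆B D → B ⊆B D
⊆B-trans B C D p q i = ≤-trans (proj₁ (q i)) (proj₁ (p i)) , ≤-trans (proj₂ (p i)) (proj₂ (q i))

⊆B-antisym : ∀ {d} (B C : Box d) → B ⊆B C → C ⊆B B → B ≡ C
⊆B-antisym B C p q = cong₂ _,_ (vec-ext λ i → ≤-antisym (proj₁ (q i)) (proj₁ (p i)))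
                           (vec-ext λ i → ≤-antisym (proj₂ (p i)) (proj₂ (q i)))

DisjointB-sym : ∀ {d} (B C : Box d) → DisjointB B C → DisjointB C B
DisjointB-sym B C (i , sep) = i , swap sep

DisjointB-⊆ : ∀ {d} (B′ B C : Box d) → B′ ⊆B B → DisjointB B C → DisjointB B′ C
DisjointB-⊆ B′ B C sub (i , inj₁ lt) = i , inj₁ (≤-<-trans (proj₂ (sub i)) lt)
DisjointB-⊆ B′ B C sub (i , inj₂ lt) = i , inj₂ (<-≤-trans lt (proj₁ (sub i)))

disjoint⇒⊈ : ∀ {d} (m : Vec ℕ d) (B C : Box d) → IsBrick m B → DisjointB B C → ¬ B ⊆B C
disjoint⇒⊈ m B C brick (i , inj₁ lt) sub = <⇒≱ (<-trans (proj₁ (brick i)) lt) (proj₁ (sub i))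
disjoint⇒⊈ m B C brick (i , inj₂ lt) sub = <⇒≱ (<-trans lt (proj₁ (brick i))) (proj₂ (sub i))

excess : ∀ {d} → Box d → ℕ
excess B = ∑ (λ i → lookup (hi B) i ∸ suc (lookup (lo B) i))

-- Strict growth under proper inclusion makes `excess`, which is w(B) - 1, a measure for inductions
-- along inclusion.
excess-< : ∀ {d} (m : Vec ℕ d) (B C : Box d) → IsBrick m B → B ⊆B C → ¬ C ⊆B B → excess B < excess C
excess-< {d} m B C brick sub ¬sub with ¬∀⟶∃¬ d _ (λ i → lookup (lo B) i ≤? lookup (lo C) i ×-dec lookup (hi C) i ≤? lookup (hi B) i) ¬sub
... | i , ¬p = sum-mono-< {d} (λ j → ∸-mono (proj₂ (sub j)) (s≤s (proj₁ (sub j)))) i strict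
  where
  strict : lookup (hi B) i ∸ suc (lookup (lo B) i) < lookup (hi C) i ∸ suc (lookup (lo C) i)
  strict with lookup (lo B) i ≤? lookup (lo C) i
  ... | no loB≰loC = <-≤-trans {j = lookup (hi B) i ∸ suc (lookup (lo C) i)} (∸-monoʳ-< (s≤s (≰⇒> loB≰loC)) (proj₁ (brick i))) (∸-monoˡ-≤ (suc (lookup (lo C) i)) (proj₂ (sub i)))
  ... | yes loB≤loC = <-≤-trans {j = lookup (hi C) i ∸ suc (lookup (lo B) i)} (∸-monoˡ-< (≰⇒> λ le → ¬p (loB≤loC , le)) (proj₁ (brick i))) (∸-monoʳ-≤ (lookup (hi C) i) (s≤s (proj₁ (sub i))))

whole : ∀ {d} → Vec ℕ d → Box d
whole {d} m = Vec.replicate d 0 , m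

brick⇒⊆whole : ∀ {d} (m : Vec ℕ d) (B : Box d) → IsBrick m B → B ⊆B whole m
brick⇒⊆whole m B brick i = ≤-trans (≤-reflexive (Vecₚ.lookup-replicate i 0)) z≤n , proj₂ (brick i)

whole-brick : ∀ {d} (m : Vec ℕ d) → (∀ i → 1 ≤ lookup m i) → IsBrick m (whole m)
whole-brick m 1≤m i = ≤-trans (≤-reflexive (cong suc (Vecₚ.lookup-replicate i 0))) (1≤m i) , ≤-refl

module MaximalSystem {d : ℕ} {m : Vec ℕ d} {H : List (Box d)} (maximal : IsMaximalSystem m H) where

  brick : ∀ {B} → B ∈ H → IsBrick m B
  brick = All.lookup (proj₁ (proj₁ maximal))

  unique : Unique H
  unique = proj₁ (proj₂ (proj₁ maximal))

  laminar : ∀ {B C} → B ∈ H → C ∈ H → (B ⊆B C) ⊎ (C ⊆B B) ⊎ DisjointB B C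
  laminar = proj₂ (proj₂ (proj₁ maximal))

  -- Otherwise `R ∷ H` would be a strictly larger system.
  compatible⇒∈ : ∀ R → IsBrick m R → (∀ {D} → D ∈ H → (R ⊆B D) ⊎ (D ⊆B R) ⊎ DisjointB R D) → R ∈ H
  compatible⇒∈ R brickR compatible with R ∈B? H
  ... | yes R∈H = R∈H
  ... | no R∉H = proj₂ maximal (R ∷ H) (brickR ∷ proj₁ (proj₁ maximal) , ¬Any⇒All¬ H R∉H ∷ unique , laminar′) there (here refl)
    where
    laminar′ : ∀ {B C} → B ∈ R ∷ H → C ∈ R ∷ H → (B ⊆B C) ⊎ (C ⊆B B) ⊎ DisjointB B C
    laminar′ (here refl) (here refl) = inj₁ (⊆B-refl R)
    laminar′ (here refl) (there q)   = compatible q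
    laminar′ {B} (there p)   (here refl) with compatible p
    ... | inj₁ sub        = inj₂ (inj₁ sub)
    ... | inj₂ (inj₁ sub) = inj₁ sub
    ... | inj₂ (inj₂ dis) = inj₂ (inj₂ (DisjointB-sym R B dis))
    laminar′ (there p)   (there q)   = laminar p q

  member : Fin (length H) → Box d
  member = List.lookup H

  count : Box d → ℕ
  count B = ∑ (λ h → ind (member h ⊆B? B))

  module Below (B : Box d) (B∈H : B ∈ H) where

    Proper : Box d → Set
    Proper C = (C ⊆B B) × ¬ (B ⊆B C)

    Proper? : ∀ C → Dec (Proper C)
    Proper? C = C ⊆B? B ×-dec ¬? (B ⊆B? C)

    -- Maximality ranges over the positions in `H`, which makes it decidable by finite search.
    Child : Box d → Set
    Child C = Proper C × (∀ h → Proper (member h) → C ⊆B member h → member h ⊆B C)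

    Child? : ∀ C → Dec (Child C)
    Child? C = Proper? C ×-dec all? λ h → Proper? (member h) →-dec (C ⊆B? member h →-dec member h ⊆B? C)

    abstract
      children : List (Box d)
      children = filter Child? H

      children-unique : Unique children
      children-unique = filter⁺ Child? unique

      ∈-children⁺ : ∀ {C} → C ∈ H → Child C → C ∈ children
      ∈-children⁺ = ∈-filter⁺ Child?

      ∈-children⁻ : ∀ {C} → C ∈ children → C ∈ H × Child C
      ∈-children⁻ = ∈-filter⁻ Child? {xs = H}

    k : ℕ
    k = length children

    child : Fin k → Box d
    child = List.lookup children

    child∈H : ∀ c → child c ∈ H
    child∈H c = proj₁ (∈-children⁻ (∈-lookup c))

    child-child : ∀ c → Child (child c)
    child-child c = proj₂ (∈-children⁻ (∈-lookup c))

    child-maximal : ∀ c {D} → D ∈ H → Proper D → child c ⊆B D → D ⊆B child c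
    child-maximal c {D} D∈H proper = subst (λ D → Proper D → child c ⊆B D → D ⊆B child c) (sym (lookup-index D∈H))
      (proj₂ (child-child c) (index D∈H)) proper

    children-disjoint : ∀ {c e} → c ≢ e → DisjointB (child c) (child e)
    children-disjoint {c} {e} c≢e with laminar (child∈H c) (child∈H e)
    ... | inj₂ (inj₂ dis) = dis
    ... | inj₁ sub = contradiction (lookup-injective children-unique c e
          (⊆B-antisym (child c) (child e) sub (child-maximal c (child∈H e) (proj₁ (child-child e)) sub))) c≢e
    ... | inj₂ (inj₁ sub) = contradiction (lookup-injective children-unique c e
          (⊆B-antisym (child c) (child e) (child-maximal e (child∈H c) (proj₁ (child-child c)) sub) sub)) c≢e

    -- Climb from `D` through larger proper members until none is left. `n` bounds the number of
    -- steps, as each one raises the excess, which stays below `excess B`.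
    below-child : ∀ n {D} → D ∈ H → Proper D → excess B ≤ n + excess D → ∃ λ c → D ⊆B child c
    below-child zero {D} D∈H (sub , ¬sub) le = contradiction le (<⇒≱ (excess-< m D B (brick D∈H) sub ¬sub))
    below-child (suc n) {D} D∈H proper le with any? (λ h → Proper? (member h) ×-dec (D ⊆B? member h ×-dec ¬? (member h ⊆B? D)))
    ... | yes (h , properE , D⊆E , E⊈D) with below-child n (∈-lookup h) properE
            (≤-trans le (≤-trans (≤-reflexive (sym (+-suc n (excess D)))) (+-monoʳ-≤ n (excess-< m D (member h) (brick D∈H) D⊆E E⊈D))))
    ... | c , E⊆c = c , ⊆B-trans D (member h) (child c) D⊆E E⊆c
    below-child (suc n) {D} D∈H proper le | no none = index D∈children , subst (D ⊆B_) (lookup-index D∈children) (⊆B-refl D)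
      where
      isChild : Child D
      isChild = proper , λ h properE D⊆E → decidable-stable (member h ⊆B? D) λ ¬sub → none (h , properE , D⊆E , ¬sub)
      D∈children : D ∈ children
      D∈children = ∈-children⁺ D∈H isChild

    proper⇒below-child : ∀ {D} → D ∈ H → Proper D → ∃ λ c → D ⊆B child c
    proper⇒below-child D∈H proper = below-child (excess B) D∈H proper (m≤m+n _ _)

    -- `B` itself lies in no child, and any other member inside `B` lies in at most one child
    -- because the children are disjoint.
    count-children : suc (∑ (λ c → count (child c))) ≤ count B
    count-children = begin
      suc (∑ (λ c → count (child c)))
        ≡⟨ cong₂ _+_ (sum-ind-≟ iB) (∑-comm {length H} {k} (λ h c → ind (member h ⊆B? child c))) ⟨
      ∑ (λ h → ind (h Fin.≟ iB)) + ∑ (λ h → ∑ (λ c → ind (member h ⊆B? child c)))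
        ≡⟨ ∑-distrib-+ {length H} (λ h → ind (h Fin.≟ iB)) (λ h → ∑ (λ c → ind (member h ⊆B? child c))) ⟨
      ∑ (λ h → ind (h Fin.≟ iB) + ∑ (λ c → ind (member h ⊆B? child c)))
        ≤⟨ sum-mono {length H} (λ h → pointwise h (member h ⊆B? B) (h Fin.≟ iB)) ⟩
      count B ∎
      where
      open ≤-Reasoning
      iB : Fin (length H)
      iB = index B∈H
      none : ∀ h → (∀ c → ¬ member h ⊆B child c) → ∑ (λ c → ind (member h ⊆B? child c)) ≤ 0
      none h ¬sub = sum-zero {k} (λ c → ind (member h ⊆B? child c)) (λ c → ≤-reflexive (ind-no (member h ⊆B? child c) (¬sub c)))
      pointwise : ∀ h (A? : Dec (member h ⊆B B)) (E? : Dec (h ≡ iB)) → ind E? + ∑ (λ c → ind (member h ⊆B? child c)) ≤ ind A?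
      pointwise h (yes _) (yes refl) = s≤s (none h λ c sub → proj₂ (proj₁ (child-child c)) (subst (_⊆B child c) (sym (lookup-index B∈H)) sub))
      pointwise h (yes _) (no _) = sum-ind≤1 (λ c → member h ⊆B? child c) one
        where
        one : ∀ {c e} → member h ⊆B child c → member h ⊆B child e → c ≡ e
        one {c} {e} p q with c Fin.≟ e
        ... | yes c≡e = c≡e
        ... | no c≢e = contradiction q (disjoint⇒⊈ m (member h) (child e) (brick (∈-lookup h)) (DisjointB-⊆ (member h) (child c) (child e) p (children-disjoint c≢e)))
      pointwise h (no ¬sub) (yes refl) = contradiction (subst (_⊆B B) (lookup-index B∈H) (⊆B-refl B)) ¬sub
      pointwise h (no ¬sub) (no _) = none h λ c sub → ¬sub (⊆B-trans (member h) (child c) B sub (proj₁ (proj₁ (child-child c))))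

    -- Every member of `H` contains `B`, is disjoint from `B` or lies in a child, so compatibility
    -- with the children extends to all of `H`. Hence `R` is a member, and if it is not `B` it lies
    -- in a child.
    saturated : ∀ R → IsBrick m R → R ⊆B B → (∀ c → (child c ⊆B R) ⊎ DisjointB (child c) R) →
      (B ⊆B R) ⊎ (∃ λ c → R ⊆B child c)
    saturated R brickR R⊆B compatible with B ⊆B? R
    ... | yes B⊆R = inj₁ B⊆R
    ... | no  B⊈R = inj₂ (proper⇒below-child (compatible⇒∈ R brickR with-H) (R⊆B , B⊈R))
      where
      with-H : ∀ {D} → D ∈ H → (R ⊆B D) ⊎ (D ⊆B R) ⊎ DisjointB R D
      with-H {D} D∈H with B ⊆B? D | laminar D∈H B∈H
      ... | yes B⊆D | _ = inj₁ (⊆B-trans R B D R⊆B B⊆D)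
      ... | no B⊈D | inj₂ (inj₁ B⊆D) = contradiction B⊆D B⊈D
      ... | no B⊈D | inj₂ (inj₂ dis) = inj₂ (inj₂ (DisjointB-⊆ R B D R⊆B (DisjointB-sym D B dis)))
      ... | no B⊈D | inj₁ D⊆B with proper⇒below-child D∈H (D⊆B , B⊈D)
      ... | c , D⊆c with compatible c
      ... | inj₁ c⊆R = inj₂ (inj₁ (⊆B-trans D (child c) R D⊆c c⊆R))
      ... | inj₂ dis = inj₂ (inj₂ (DisjointB-sym D R (DisjointB-⊆ D (child c) R D⊆c dis)))

    packing : Packing (lookup (lo B)) (lookup (hi B)) (λ c → lookup (lo (child c))) (λ c → lookup (hi (child c)))
    packing = record
      { ambient   = λ i → proj₁ (brick B∈H i)
      ; brick     = λ c i → proj₁ (brick (child∈H c) i)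
      ; inside    = λ c → proj₁ (proj₁ (child-child c))
      ; proper    = λ c full → proj₂ (proj₁ (child-child c)) full
      ; disjoint  = children-disjoint
      ; saturated = sat
      }
      where
      sat : ∀ (a b : Fin d → ℕ) → (∀ i → lookup (lo B) i ≤ a i × a i < b i × b i ≤ lookup (hi B) i) →
        (∀ c → (∀ i → a i ≤ lookup (lo (child c)) i × lookup (hi (child c)) i ≤ b i) ⊎
               (∃ λ i → lookup (hi (child c)) i < a i ⊎ b i < lookup (lo (child c)) i)) →
        (∀ i → a i ≤ lookup (lo B) i × lookup (hi B) i ≤ b i) ⊎
        (∃ λ c → ∀ i → lookup (lo (child c)) i ≤ a i × b i ≤ lookup (hi (child c)) i)
      sat a b box compatible = result (saturated R brickR R⊆B compatible′)
        where
        R : Box d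
        R = tabulate a , tabulate b
        a≡ : ∀ i → lookup (tabulate a) i ≡ a i
        a≡ = Vecₚ.lookup∘tabulate a
        b≡ : ∀ i → lookup (tabulate b) i ≡ b i
        b≡ = Vecₚ.lookup∘tabulate b
        brickR : IsBrick m R
        brickR i rewrite a≡ i | b≡ i = proj₁ (proj₂ (box i)) , ≤-trans (proj₂ (proj₂ (box i))) (proj₂ (brick B∈H i))
        R⊆B : R ⊆B B
        R⊆B i rewrite a≡ i | b≡ i = proj₁ (box i) , proj₂ (proj₂ (box i))
        compatible′ : ∀ c → (child c ⊆B R) ⊎ DisjointB (child c) R
        compatible′ c with compatible c
        ... | inj₁ sub = inj₁ λ i → subst (_≤ lookup (lo (child c)) i) (sym (a≡ i)) (proj₁ (sub i)) ,
                                    subst (lookup (hi (child c)) i ≤_) (sym (b≡ i)) (proj₂ (sub i))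
        ... | inj₂ (i , inj₁ lt) = inj₂ (i , inj₁ (subst (lookup (hi (child c)) i <_) (sym (a≡ i)) lt))
        ... | inj₂ (i , inj₂ lt) = inj₂ (i , inj₂ (subst (_< lookup (lo (child c)) i) (sym (b≡ i)) lt))
        result : (B ⊆B R) ⊎ (∃ λ c → R ⊆B child c) →
          (∀ i → a i ≤ lookup (lo B) i × lookup (hi B) i ≤ b i) ⊎
          (∃ λ c → ∀ i → lookup (lo (child c)) i ≤ a i × b i ≤ lookup (hi (child c)) i)
        result (inj₁ sub) = inj₁ λ i → subst (_≤ lookup (lo B) i) (a≡ i) (proj₁ (sub i)) , subst (lookup (hi B) i ≤_) (b≡ i) (proj₂ (sub i))
        result (inj₂ (c , sub)) = inj₂ (c , λ i → subst (lookup (lo (child c)) i ≤_) (a≡ i) (proj₁ (sub i)) , subst (_≤ lookup (hi (child c)) i) (b≡ i) (proj₂ (sub i)))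

  -- This is w(B) ≤ `count B`, by induction on a bound `n` for the excess: the packing inequality,
  -- the hypothesis for each child, and one more member for `B` itself.
  excess<count : ∀ n B → B ∈ H → excess B < n → excess B < count B
  excess<count (suc n) B B∈H (s≤s le) = begin-strict
    excess B                                      ≤⟨ Bound.packing-bound packing ⟩
    ∑ (λ c → suc (excess (child c)))            ≤⟨ sum-mono {k} (λ c → excess<count n (child c) (child∈H c)
                                                       (<-≤-trans (excess-< m (child c) B (brick (child∈H c)) (proj₁ (proj₁ (child-child c))) (proj₂ (proj₁ (child-child c)))) le)) ⟩
    ∑ (λ c → count (child c))                   <⟨ count-children ⟩
    count B                                       ∎
    where
    open ≤-Reasoning
    open Below B B∈H

  excess<length : (∀ i → 1 ≤ lookup m i) → excess (whole m) < length H
  excess<length 1≤m = ≤-trans (excess<count (suc (excess (whole m))) (whole m) whole∈H ≤-refl)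
    (≤-trans (sum-mono {length H} (λ h → ind≤1 (member h ⊆B? whole m))) (≤-reflexive (trans (sum-const (length H) 1) (*-identityʳ _))))
    where
    whole∈H : whole m ∈ H
    whole∈H = compatible⇒∈ (whole m) (whole-brick m 1≤m) (λ {D} D∈H → inj₂ (inj₁ (brick⇒⊆whole m D (brick D∈H))))

-- The upper bound

-- A chain of bricks from the whole of [0 , v] down to a unit cube, each
-- obtained from the previous one by cutting off a layer of width 1.
record Chain {d : ℕ} (v : Vec ℕ d) (n : ℕ) : Set where
  field
    boxes     : List (Box d)
    bricks    : All (IsBrick v) boxes
    unique    : Unique boxes
    nested    : ∀ {B C} → B ∈ boxes → C ∈ boxes → (B ⊆B C) ⊎ (C ⊆B B)
    top       : whole v ∈ boxes
    size      : length boxes ≡ suc n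
    saturated : ∀ {R} → IsBrick v R → (∀ {B} → B ∈ boxes → (R ⊆B B) ⊎ (B ⊆B R) ⊎ DisjointB R B) → R ∈ boxes

whole-cong : ∀ {d} (v : Vec ℕ d) (R : Box d) → IsBrick v R → (∀ i → lookup (lo R) i ≤ 0) → (∀ i → lookup v i ≤ lookup (hi R) i) → R ≡ whole v
whole-cong v R brickR lo≤0 v≤hi = ⊆B-antisym R (whole v) (brick⇒⊆whole v R brickR)
  λ i → ≤-trans (lo≤0 i) z≤n , v≤hi i

-- `n` is the number of layers to cut off. While it is positive, some axis has length at least 2;
-- shortening that axis by 1 gives `v′`, and [0 , v] is put in front of the chain for `v′`.
chain : ∀ {d} n (v : Vec ℕ d) → (∀ i → 1 ≤ lookup v i) → ∑ (λ i → lookup v i ∸ 1) ≡ n → Chain v n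
chain {d} zero v 1≤v eq = record
  { boxes = whole v ∷ [] ; bricks = whole-brick v 1≤v ∷ [] ; unique = [] ∷ []
  ; nested = λ { (here refl) (here refl) → inj₁ (⊆B-refl (whole v)) } ; top = here refl ; size = refl
  ; saturated = λ {R} brickR _ → here (whole-cong v R brickR
      (λ i → ≤-pred (≤-trans (proj₁ (brickR i)) (≤-trans (proj₂ (brickR i)) (v≤1 i))))
      (λ i → ≤-trans (v≤1 i) (≤-trans (s≤s z≤n) (proj₁ (brickR i))))) }
  where
  v≤1 : ∀ i → lookup v i ≤ 1
  v≤1 i = m∸n≡0⇒m≤n (n≤0⇒n≡0 (≤-trans (term≤∑ (λ i → lookup v i ∸ 1) i) (≤-reflexive eq)))
chain {d} (suc n) v 1≤v eq = extend (any? λ i → 2 ≤? lookup v i)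
  where
  extend : Dec (∃ λ i → 2 ≤ lookup v i) → Chain v (suc n)
  extend (no none) = contradiction (≤-trans (≤-reflexive (sym eq)) (sum-zero {d} (λ i → lookup v i ∸ 1)
    λ i → ≤-reflexive (m≤n⇒m∸n≡0 (≤-pred (≰⇒> λ 2≤ → none (i , 2≤)))))) λ ()
  extend (yes (i , 2≤v)) = record
    { boxes = whole v ∷ boxes ; bricks = whole-brick v 1≤v ∷ All.map (λ {B} → widen B) bricks
    ; unique = ¬Any⇒All¬ boxes whole∉ ∷ unique ; nested = nested′ ; top = here refl ; size = cong suc size
    ; saturated = saturated′ }
    where
    f : Fin d → ℕ
    f = set (lookup v) i (lookup v i ∸ 1)
    v′ : Vec ℕ d
    v′ = tabulate f
    v′≡ : ∀ j → lookup v′ j ≡ f j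
    v′≡ = Vecₚ.lookup∘tabulate f
    v′i≡ : lookup v′ i ≡ lookup v i ∸ 1
    v′i≡ = trans (v′≡ i) (set-≡ (lookup v) i _)
    v′≢ : ∀ {j} → j ≢ i → lookup v′ j ≡ lookup v j
    v′≢ {j} j≢i = trans (v′≡ j) (set-≢ (lookup v) i _ j≢i)
    1+v′i≡ : suc (lookup v′ i) ≡ lookup v i
    1+v′i≡ = trans (cong suc v′i≡) (m+[n∸m]≡n (≤-trans (s≤s z≤n) 2≤v))
    1≤v′ : ∀ j → 1 ≤ lookup v′ j
    1≤v′ j = subst (1 ≤_) (sym (v′≡ j)) (set-elim (1 ≤_) (lookup v) i _ j (λ _ → ∸-monoˡ-≤ 1 2≤v) (λ _ → 1≤v j))
    v′≤v : ∀ j → lookup v′ j ≤ lookup v j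
    v′≤v j = subst (_≤ lookup v j) (sym (v′≡ j)) (set-elim (_≤ lookup v j) (lookup v) i _ j (λ { refl → m∸n≤m _ 1 }) (λ _ → ≤-refl))
    eq′ : ∑ (λ j → lookup v′ j ∸ 1) ≡ n
    eq′ = suc-injective (begin-equality
      suc (∑ (λ j → lookup v′ j ∸ 1))
        ≡⟨ cong suc (sum-split (λ j → lookup v′ j ∸ 1) i) ⟩
      suc (lookup v′ i ∸ 1) + ∑ ((λ j → lookup v′ j ∸ 1) ∖ i)
        ≡⟨ cong₂ _+_ (trans (m+[n∸m]≡n (1≤v′ i)) v′i≡) (sum-cong-≗ {d} λ j → set-elim₂ _≡_ (λ j → lookup v′ j ∸ 1) (λ j → lookup v j ∸ 1) i 0 0 j (λ _ → refl) (λ j≢i → cong (_∸ 1) (v′≢ j≢i))) ⟩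
      (lookup v i ∸ 1) + ∑ ((λ j → lookup v j ∸ 1) ∖ i)
        ≡⟨ sum-split (λ j → lookup v j ∸ 1) i ⟨
      ∑ (λ j → lookup v j ∸ 1)
        ≡⟨ eq ⟩
      suc n ∎)
      where open ≤-Reasoning
    open Chain (chain n v′ 1≤v′ eq′)
    widen : ∀ B → IsBrick v′ B → IsBrick v B
    widen B brickB j = proj₁ (brickB j) , ≤-trans (proj₂ (brickB j)) (v′≤v j)
    whole∉ : whole v ∉ boxes
    whole∉ w∈ = <⇒≱ (≤-reflexive 1+v′i≡) (proj₂ (All.lookup bricks w∈ i))
    nested′ : ∀ {B C} → B ∈ whole v ∷ boxes → C ∈ whole v ∷ boxes → (B ⊆B C) ⊎ (C ⊆B B)
    nested′ (here refl) (here refl) = inj₁ (⊆B-refl (whole v))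
    nested′ {C = C} (here refl) (there C∈) = inj₂ (brick⇒⊆whole v C (widen C (All.lookup bricks C∈)))
    nested′ {B = B} (there B∈) (here refl) = inj₁ (brick⇒⊆whole v B (widen B (All.lookup bricks B∈)))
    nested′ (there B∈) (there C∈) = nested B∈ C∈
    saturated′ : ∀ {R} → IsBrick v R → (∀ {B} → B ∈ whole v ∷ boxes → (R ⊆B B) ⊎ (B ⊆B R) ⊎ DisjointB R B) → R ∈ whole v ∷ boxes
    -- `R` is compared with the top [0 , v′] of the shorter chain. Inside it the induction
    -- hypothesis applies; disjoint from it there is no brick, since [0 , v] exceeds it by one unit
    -- only.
    saturated′ {R} brickR compatible with compatible (there top)
    ... | inj₁ R⊆ = there (saturated (λ j → proj₁ (brickR j) , proj₂ (R⊆ j)) (λ B∈ → compatible (there B∈)))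
    ... | inj₂ (inj₂ (j , inj₁ lt)) = contradiction (≤-trans lt (≤-reflexive (Vecₚ.lookup-replicate j 0))) λ ()
    ... | inj₂ (inj₂ (j , inj₂ lt)) with j Fin.≟ i
    ... | yes refl = contradiction (≤-trans (≤-reflexive (sym 1+v′i≡)) lt) (<⇒≱ (<-≤-trans (proj₁ (brickR i)) (proj₂ (brickR i))))
    ... | no j≢i = contradiction (≤-trans (proj₁ (brickR j)) (proj₂ (brickR j))) (<⇒≱ (s≤s (<⇒≤ (subst (_< lookup (lo R) j) (v′≢ j≢i) lt))))
    -- Containing [0 , v′], `R` is free only in its upper end along `i`, which is `lookup v i` or
    -- one less: `R` is [0 , v] or [0 , v′].
    saturated′ {R} brickR compatible | inj₂ (inj₁ ⊆R) with lookup v i ≤? lookup (hi R) i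
    ... | yes v≤hi = here (whole-cong v R brickR lo≤0 v≤hi′)
      where
      lo≤0 : ∀ j → lookup (lo R) j ≤ 0
      lo≤0 j = ≤-trans (proj₁ (⊆R j)) (≤-reflexive (Vecₚ.lookup-replicate j 0))
      v≤hi′ : ∀ j → lookup v j ≤ lookup (hi R) j
      v≤hi′ j with j Fin.≟ i
      ... | yes refl = v≤hi
      ... | no j≢i = subst (_≤ lookup (hi R) j) (v′≢ j≢i) (proj₂ (⊆R j))
    ... | no v≰hi = there (subst (_∈ boxes) (sym (whole-cong v′ R brickR′ (λ j → ≤-trans (proj₁ (⊆R j)) (≤-reflexive (Vecₚ.lookup-replicate j 0))) (λ j → proj₂ (⊆R j)))) top)
      where
      brickR′ : IsBrick v′ R
      brickR′ j with j Fin.≟ i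
      ... | yes refl = proj₁ (brickR j) , ≤-pred (subst (lookup (hi R) i <_) (sym 1+v′i≡) (≰⇒> v≰hi))
      ... | no j≢i = proj₁ (brickR j) , subst (lookup (hi R) j ≤_) (sym (v′≢ j≢i)) (proj₂ (brickR j))

chain⇒maximal : ∀ {d} {v : Vec ℕ d} {n} (C : Chain v n) → IsMaximalSystem v (Chain.boxes C)
chain⇒maximal {v = v} C = (bricks , unique , λ B∈ C∈ → [ inj₁ , (λ sub → inj₂ (inj₁ sub)) ]′ (nested B∈ C∈)) ,
  λ H′ system ⊆H′ B∈H′ → saturated (All.lookup (proj₁ system) B∈H′) (λ C∈ → proj₂ (proj₂ system) B∈H′ (⊆H′ C∈))
  where open Chain C

vec-sum : ∀ {d} (v : Vec ℕ d) → (∀ i → 1 ≤ lookup v i) → sum v ≡ d + ∑ (λ i → lookup v i ∸ 1)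
vec-sum []      _   = refl
vec-sum {suc d} (x ∷ v) 1≤v = begin-equality
  x + sum v                                              ≡⟨ cong₂ _+_ (sym (m+[n∸m]≡n (1≤v zero))) (vec-sum v (1≤v ∘ suc)) ⟩
  suc (x ∸ 1) + (d + ∑ (λ i → lookup v i ∸ 1))             ≡⟨ solve 3 (λ a b c → con 1 :+ a :+ (b :+ c) := con 1 :+ b :+ (a :+ c)) refl (x ∸ 1) d _ ⟩
  suc d + (x ∸ 1 + ∑ (λ i → lookup v i ∸ 1))               ∎
  where open ≤-Reasoning

-- All entries are at least 1, so `sum v` is at least `d` and the truncated subtraction is exact.
minimum≡ : ∀ {d} (v : Vec ℕ d) → (∀ i → 1 ≤ lookup v i) → sum v + 1 ∸ d ≡ suc (∑ (λ i → lookup v i ∸ 1))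
minimum≡ {d} v 1≤v = trans (cong (λ x → x + 1 ∸ d) (vec-sum v 1≤v))
  (trans (cong (_∸ d) (+-assoc d _ 1)) (trans (m+n∸m≡n d _) (+-comm _ 1)))

excess-whole : ∀ {d} (v : Vec ℕ d) → excess (whole v) ≡ ∑ (λ i → lookup v i ∸ 1)
excess-whole {d} v = sum-cong-≗ {d} λ i → cong (λ x → lookup v i ∸ suc x) (Vecₚ.lookup-replicate i 0)

theorem1 : (d : ℕ) → 1 ≤ d → (m : Vec ℕ d) → ((i : Fin d) → 1 ≤ lookup m i)
    → IsMinMaxSystemSize m (sum m + 1 ∸ d)
theorem1 d _ m 1≤m =
  (Chain.boxes C , chain⇒maximal C , trans (Chain.size C) (sym (minimum≡ m 1≤m))) ,
  λ H maximal → ≤-trans (≤-reflexive (trans (minimum≡ m 1≤m) (cong suc (sym (excess-whole m)))))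
                        (MaximalSystem.excess<length {m = m} maximal 1≤m)
  where
  C : Chain m (∑ (λ i → lookup m i ∸ 1))
  C = chain _ m 1≤m refl
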